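{- Let $R$ be a principal ideal domain and let $I=gR\subsetneq R$ be a proper, non-prime ideal such that $Q:=R/I$ is finite. Write $g=u\cdot\prod_{i=1}^n p_i^{m_i}$ with $u$ a unit, $p_1,\dots,p_n$ pairwise non-associated prime elements and integers $m_1,\dots,m_n\ge 1$. Suppose $n\ge 2$. Then the zero divisor graph $\Gamma(Q)$ satisfies \[\mathrm{box}(\Gamma(Q))=\begin{cases} n & \text{if there is } i\in[n] \text{ with } m_i\ge 3,\\ n & \text{if } m_i=2 \text{ or } |R/p_iR|\ge 3 \text{ for every } i\in[n],\\ n-1 & \text{if } n\ge 3,\ m_i\in\{1,2\} \text{ for all } i\in[n], \text{ and there is } i\in[n] \text{ with } m_i=1 \text{ and } |R/p_iR|=2,\\ 1 & \text{if } n=2,\ m_1,m_2\in\{1,2\}, \text{ and there is exactly one } i\in\{1,2\} \text{ with } m_i=1 \text{ and } |R/p_iR|=2,\\ 0 & \text{if } n=2,\ m_1=m_2=1 \text{ and } |R/p_1R|=|R/p_2R|=2. \end{cases}\]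
   Context: $[n]=\{1,\dots,n\}$. Rings are commutative and non-zero with $1$. For a ring $Q$, $Z(Q)$ is the set of $r\in Q$ for which there is $s\in Q\setminus\{0\}$ with $rs=0$. The zero divisor graph $\Gamma(Q)$ has vertex set $Z(Q)\setminus\{0\}$; two distinct vertices $r,s$ are adjacent iff $rs=0$. The boxicity $\mathrm{box}(G)$ of a finite simple graph $G$ is the minimum integer $d\ge 0$ such that there exist $d$ interval graphs $I_1,\dots,I_d$ on the vertex set $V(G)$ with $E(G)=\bigcap_{j=1}^d E(I_j)$; the empty intersection ($d=0$) is the set of all pairs of vertices, so $\mathrm{box}(G)=0$ iff $G$ is complete. -}

module Defs where

open import Level using (Level; _⊔_; suc; 0ℓ)
open import Algebra.Bundles using (CommutativeRing; Semiring)
import Algebra.Definitions.RawMagma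
import Algebra.Definitions.RawSemiring
import Algebra.Properties.Ring
import Algebra.Properties.CommutativeSemigroup
import Algebra.Properties.Semiring.Divisibility
open import Data.Fin.Base using (Fin)
open import Data.Nat.Base using (ℕ; _≤_)
open import Data.Product.Base using (Σ-syntax; ∃; _×_; _,_; proj₁)
open import Data.Rational.Base as ℚ using (ℚ)
open import Data.Sum.Base using (_⊎_)
open import Function.Bundles using (Bijection; Injection; _⇔_)
open import Relation.Binary.Bundles using (Setoid)
open import Relation.Binary.Core using (Rel)
open import Relation.Binary.Definitions using (Symmetric; Irreflexive; _Respects₂_)
import Relation.Binary.Construct.On as On
open import Relation.Binary.PropositionalEquality.Properties using (setoid)
open import Relation.Nullary.Negation.Core using (¬_)
open import Relation.Unary using (Pred; _∈_; _∉_; _⊆_; _≐_)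

private
  variable
    a c i ℓ v e : Level

HasCardinality : Setoid c ℓ → ℕ → Set (c ⊔ ℓ)
HasCardinality X k = Bijection (setoid (Fin k)) X

Finite : Setoid c ℓ → Set (c ⊔ ℓ)
Finite X = ∃ (HasCardinality X)

HasAtLeast : Setoid c ℓ → ℕ → Set (c ⊔ ℓ)
HasAtLeast X k = Injection (setoid (Fin k)) X

-- Two-sided Dedekind cuts of ℚ.
record ℝ : Set₁ where
  field
    L U         : Pred ℚ 0ℓ
    L-inhabited : ∃ L
    U-inhabited : ∃ U
    L-rounded   : ∀ q → L q ⇔ (∃ λ r → q ℚ.< r × L r)
    U-rounded   : ∀ q → U q ⇔ (∃ λ r → r ℚ.< q × U r)
    disjoint    : ∀ q → ¬ (L q × U q)
    located     : ∀ q r → q ℚ.< r → L q ⊎ U r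

infix 4 _≤ᴿ_ _≈ᴿ_

_≤ᴿ_ : Rel ℝ 0ℓ
x ≤ᴿ y = ℝ.L x ⊆ ℝ.L y

_≈ᴿ_ : Rel ℝ 0ℓ
x ≈ᴿ y = x ≤ᴿ y × y ≤ᴿ x

record Interval : Set₁ where
  field
    lo hi : ℝ
    lo≤hi : lo ≤ᴿ hi

_∈ᴵ_ : ℝ → Interval → Set
x ∈ᴵ J = Interval.lo J ≤ᴿ x × x ≤ᴿ Interval.hi J

_≈ᴵ_ : Rel Interval 0ℓ
J ≈ᴵ K = Interval.lo J ≈ᴿ Interval.lo K × Interval.hi J ≈ᴿ Interval.hi K

_Meets_ : Rel Interval (suc 0ℓ)
J Meets K = ∃ λ x → x ∈ᴵ J × x ∈ᴵ K

record SimpleGraph (V : Setoid v e) (a : Level) : Set (v ⊔ e ⊔ suc a) where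
  open Setoid V
  field
    Adj        : Rel Carrier a
    adj-resp   : Adj Respects₂ _≈_
    adj-sym    : Symmetric Adj
    adj-irrefl : Irreflexive _≈_ Adj

module _ {V : Setoid v e} where
  open Setoid V

  record IsIntervalGraph (G : SimpleGraph V a) : Set (v ⊔ e ⊔ a ⊔ suc 0ℓ) where
    open SimpleGraph G
    field
      interval      : Carrier → Interval
      interval-cong : ∀ {x y} → x ≈ y → interval x ≈ᴵ interval y
      adj⇔meets     : ∀ {x y} → x ≉ y → Adj x y ⇔ (interval x Meets interval y)

  -- For d = 0 the right-hand side of the equivalence is vacuously true, so
  -- the empty intersection consists of all pairs of distinct vertices.
  IsIntersectionOfIntervalGraphs : SimpleGraph V a → ℕ → Set (v ⊔ e ⊔ suc a ⊔ suc 0ℓ)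
  IsIntersectionOfIntervalGraphs {a = a} G d =
    Σ[ I ∈ (Fin d → SimpleGraph V a) ]
      (∀ j → IsIntervalGraph (I j)) ×
      (∀ {x y} → x ≉ y → SimpleGraph.Adj G x y ⇔ (∀ j → SimpleGraph.Adj (I j) x y))

  HasBoxicity : SimpleGraph V a → ℕ → Set (v ⊔ e ⊔ suc a ⊔ suc 0ℓ)
  HasBoxicity G d =
    IsIntersectionOfIntervalGraphs G d ×
    (∀ d′ → IsIntersectionOfIntervalGraphs G d′ → d ≤ d′)

module _ (Q : CommutativeRing c ℓ) where
  open CommutativeRing Q

  IsZeroDivisor : Pred Carrier (c ⊔ ℓ)
  IsZeroDivisor r = ∃ λ s → s ≉ 0# × r * s ≈ 0#

  nonZeroZeroDivisors : Setoid (c ⊔ ℓ) ℓ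
  nonZeroZeroDivisors = On.setoid {B = ∃ λ r → IsZeroDivisor r × r ≉ 0#}
    (CommutativeRing.setoid Q) proj₁

  zeroDivisorGraph : SimpleGraph nonZeroZeroDivisors ℓ
  zeroDivisorGraph = record
    { Adj        = λ (r , _) (s , _) → r ≉ s × r * s ≈ 0#
    ; adj-resp   = (λ s≈s′ (r≉s , rs≈0) →
                      (λ r≈s′ → r≉s (trans r≈s′ (sym s≈s′))) ,
                      trans (*-congˡ (sym s≈s′)) rs≈0)
                 , (λ r≈r′ (r≉s , rs≈0) →
                      (λ r′≈s → r≉s (trans r≈r′ r′≈s)) ,
                      trans (*-congʳ (sym r≈r′)) rs≈0)
    ; adj-sym    = λ (r≉s , rs≈0) → (λ s≈r → r≉s (sym s≈r)) , trans (*-comm _ _) rs≈0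
    ; adj-irrefl = λ r≈s (r≉s , _) → r≉s r≈s
    }

module RingNotions (R : CommutativeRing c ℓ) where
  open CommutativeRing R public
    using (Carrier; _≈_; _≉_; _+_; _*_; _-_; 0#; 1#)
  open CommutativeRing R hiding (Carrier; _≈_; _≉_; _+_; _*_; _-_; 0#; 1#)
  open Algebra.Definitions.RawSemiring (Semiring.rawSemiring semiring) public
    using (_∣_; _^_; product; Prime)
  open Algebra.Definitions.RawMagma (Semiring.*-rawMagma semiring) public using (_∦_)
  open Algebra.Properties.Semiring.Divisibility semiring
    using (∣-respʳ; _∣0; x∣ʳy⇒x∣ʳzy)
  open Algebra.Properties.Ring ring
    using (-‿+-comm; -‿distribˡ-*; -‿distribʳ-*; -‿involutive)
  open Algebra.Properties.CommutativeSemigroup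
    (CommutativeRing.+-commutativeSemigroup R) using (interchange)

  IsUnit : Pred Carrier (c ⊔ ℓ)
  IsUnit x = x ∣ 1#

  record Ideal (i : Level) : Set (c ⊔ ℓ ⊔ suc i) where
    field
      Mem      : Pred Carrier i
      Mem-resp : ∀ {x y} → x ≈ y → x ∈ Mem → y ∈ Mem
      0∈       : 0# ∈ Mem
      +-closed : ∀ {x y} → x ∈ Mem → y ∈ Mem → x + y ∈ Mem
      *-closed : ∀ r {x} → x ∈ Mem → r * x ∈ Mem

  ⟨_⟩ : Carrier → Ideal (c ⊔ ℓ)
  ⟨ g ⟩ = record
    { Mem      = g ∣_
    ; Mem-resp = ∣-respʳ
    ; 0∈       = g ∣0
    ; +-closed = λ (q , qg≈x) (q′ , q′g≈y) →
        q + q′ , trans (distribʳ g q q′) (+-cong qg≈x q′g≈y)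
    ; *-closed = λ r → x∣ʳy⇒x∣ʳzy r
    }
    where open Algebra.Definitions.RawMagma (Semiring.*-rawMagma semiring) using (_,_)

  IsProper : Ideal i → Set i
  IsProper I = 1# ∉ Ideal.Mem I

  record IsPrimeIdeal (I : Ideal i) : Set (c ⊔ i) where
    open Ideal I
    field
      proper : IsProper I
      split  : ∀ {x y} → x * y ∈ Mem → x ∈ Mem ⊎ y ∈ Mem

  -- Ideals are arbitrary predicates, not just decidable ones, so 'principal'
  -- already yields excluded middle at level c ⊔ ℓ: consider, for a type P,
  -- the ideal of all x with x ≈ 0# ⊎ P.
  record IsPrincipalIdealDomain : Set (suc (c ⊔ ℓ)) where
    field
      1≉0            : 1# ≉ 0#
      noZeroDivisors : ∀ {x y} → x * y ≈ 0# → x ≈ 0# ⊎ y ≈ 0#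
      principal      : (I : Ideal (c ⊔ ℓ)) → ∃ λ g → Ideal.Mem I ≐ Ideal.Mem ⟨ g ⟩

  module _ (I : Ideal i) where
    open Ideal I

    private
      _~_ : Rel Carrier i
      x ~ y = x - y ∈ Mem

      ≈⇒~ : ∀ {x y} → x ≈ y → x ~ y
      ≈⇒~ x≈y = Mem-resp (sym (trans (+-congʳ x≈y) (-‿inverseʳ _))) 0∈

      neg : ∀ {x} → x ∈ Mem → - x ∈ Mem
      neg x∈ = Mem-resp
        (trans (sym (-‿distribˡ-* 1# _)) (-‿cong (*-identityˡ _)))
        (*-closed (- 1#) x∈)

      x-y+y-z≈x-z : ∀ x y z → (x - y) + (y - z) ≈ x - z
      x-y+y-z≈x-z x y z = trans (+-assoc x (- y) (y - z))
        (+-congˡ (trans (sym (+-assoc (- y) y (- z)))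
          (trans (+-congʳ (-‿inverseˡ y)) (+-identityˡ (- z)))))

      ~-sym : ∀ {x y} → x ~ y → y ~ x
      ~-sym {x} {y} x~y = Mem-resp
        (trans (sym (-‿+-comm x (- y)))
          (trans (+-congˡ (-‿involutive y)) (+-comm (- x) y)))
        (neg x~y)

      ~-trans : ∀ {x y z} → x ~ y → y ~ z → x ~ z
      ~-trans x~y y~z = Mem-resp (x-y+y-z≈x-z _ _ _) (+-closed x~y y~z)

      ~-+-cong : ∀ {x y u v} → x ~ y → u ~ v → (x + u) ~ (y + v)
      ~-+-cong {x} {y} {u} {v} x~y u~v = Mem-resp
        (trans (interchange x (- y) u (- v)) (+-congˡ (-‿+-comm y v)))
        (+-closed x~y u~v)

      ~-neg-cong : ∀ {x y} → x ~ y → (- x) ~ (- y)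
      ~-neg-cong {x} {y} x~y = Mem-resp (sym (-‿+-comm x (- y))) (neg x~y)

      ~-*-congˡ : ∀ {x u v} → u ~ v → (x * u) ~ (x * v)
      ~-*-congˡ {x} {u} {v} u~v = Mem-resp
        (trans (distribˡ x u (- v)) (+-congˡ (sym (-‿distribʳ-* x v))))
        (*-closed x u~v)

      ~-*-cong : ∀ {x y u v} → x ~ y → u ~ v → (x * u) ~ (y * v)
      ~-*-cong x~y u~v = ~-trans (~-*-congˡ u~v)
        (~-trans (≈⇒~ (*-comm _ _))
          (~-trans (~-*-congˡ x~y) (≈⇒~ (*-comm _ _))))

    quotientRing : CommutativeRing c i
    quotientRing = record
      { Carrier = Carrier
      ; _≈_ = _~_
      ; _+_ = _+_
      ; _*_ = _*_
      ; -_  = -_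
      ; 0#  = 0#
      ; 1#  = 1#
      ; isCommutativeRing = record
        { isRing = record
          { +-isAbelianGroup = record
            { isGroup = record
              { isMonoid = record
                { isSemigroup = record
                  { isMagma = record
                    { isEquivalence = record
                      { refl  = ≈⇒~ refl
                      ; sym   = ~-sym
                      ; trans = ~-trans
                      }
                    ; ∙-cong = ~-+-cong
                    }
                  ; assoc = λ x y z → ≈⇒~ (+-assoc x y z)
                  }
                ; identity = (λ x → ≈⇒~ (+-identityˡ x)) , (λ x → ≈⇒~ (+-identityʳ x))
                }
              ; inverse = (λ x → ≈⇒~ (-‿inverseˡ x)) , (λ x → ≈⇒~ (-‿inverseʳ x))
              ; ⁻¹-cong = ~-neg-cong
              }
            ; comm = λ x y → ≈⇒~ (+-comm x y)
            }
          ; *-cong     = ~-*-cong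
          ; *-assoc    = λ x y z → ≈⇒~ (*-assoc x y z)
          ; *-identity = (λ x → ≈⇒~ (*-identityˡ x)) , (λ x → ≈⇒~ (*-identityʳ x))
          ; distrib    = (λ x y z → ≈⇒~ (distribˡ x y z)) , (λ x y z → ≈⇒~ (distribʳ x y z))
          }
        ; *-comm = λ x y → ≈⇒~ (*-comm x y)
        }
      }

    quotientSetoid : Setoid c i
    quotientSetoid = CommutativeRing.setoid quotientRing

{-# OPTIONS --safe #-}

-- Let v i x be the exponent of p i in x, capped at m i, so that x y ≈ 0 in Q iff
-- m i ≤ v i x + v i y for all i. Each of these conditions defines an interval
-- graph up to loops: for 2 v < m put the point m ∸ v, perturbed to make points
-- of distinct vertices disjoint, and for 2 v ≥ m the interval [0, v]. If m k = 1
-- and p k has only two residues, the condition at k can be merged into the other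
-- graphs, since distinct vertices that violate it agree at k and so cannot both
-- have full exponent everywhere else.
--
-- For the lower bound n there are n pairs of non-adjacent vertices such that
-- vertices of different pairs are adjacent; as an interval graph has no induced
-- 4-cycle, different pairs are separated by different graphs. For the bound
-- n ∸ 1 consider the non-adjacent vertices {i} and {i,k}, where a set stands for
-- the product of all p l ^ m l with l outside it. The pairs {i,k} for which
-- {i} and {i,k} are separated by a given graph intersect each other, and no
-- graph separates all six ordered pairs from a triangle, which is enough for a
-- counting argument.

module Submission where

open import Defs
open import Level using (Lift; lift; 0ℓ; _⊔_)
open import Algebra.Bundles using (CommutativeRing)
import Algebra.Definitions.RawMagma
open import Data.Empty using (⊥; ⊥-elim)
open import Data.Fin.Base
  using (Fin; zero; suc; punchIn; punchOut; combine; remQuot; toℕ; fromℕ<)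
open import Data.Fin.Patterns
open import Data.Fin.Properties
  using (_≟_; any?; all?; punchIn-injective; punchIn-punchOut; punchInᵢ≢i; toℕ<n; toℕ-fromℕ<;
    toℕ-injective; suc-injective; combine-injective; combine-remQuot; injective⇒≤; ¬∀⟶∃¬)
open import Data.Nat.Base as ℕ using (ℕ; zero; suc; _∸_; _≤_; _<_; _≥_; z≤n; s≤s)
import Data.Nat.Properties as ℕ
import Data.Nat.Solver
open import Data.Product using (∃; ∃!; _×_; _,_; proj₁; proj₂; uncurry)
open import Data.Product.Properties using (,-injectiveˡ; ,-injectiveʳ)
open import Data.Rational.Base as ℚ using (ℚ)
import Data.Rational.Properties as ℚ
open import Data.Sum.Base as Sum using (_⊎_; inj₁; inj₂; swap; [_,_]′)
open import Data.Vec.Base using (Vec; []; _∷_; lookup)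
open import Data.Vec.Functional using (Vector)
open import Function.Base using (_∘_; id)
open import Function.Bundles using (_⇔_; mk⇔; module Equivalence; Bijection; Injection)
open import Relation.Binary.Bundles using (Setoid)
open import Relation.Binary.Definitions using (tri<; tri≈; tri>)
open import Relation.Binary.PropositionalEquality as ≡
  using (_≡_; _≢_; refl; sym; cong; cong₂; subst; module ≡-Reasoning)
open import Relation.Nullary using (Dec; yes; no; contradiction; ¬?; _×-dec_; _⊎-dec_; _→-dec_)
open import Relation.Nullary.Decidable using (decidable-stable; from-yes)
open import Relation.Nullary.Negation.Core using (¬_)

-- Intersecting families of pairs and a counting bound.

_∈₂_,_ : ∀ {n} → Fin n → Fin n → Fin n → Set
x ∈₂ a , b = x ≡ a ⊎ x ≡ b

∃⊎∀ : ∀ {p q n} {P : Fin n → Set p} {Q : Fin n → Set q} →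
  (∀ j → P j ⊎ Q j) → ∃ P ⊎ (∀ j → Q j)
∃⊎∀ {n = zero}  f = inj₂ λ ()
∃⊎∀ {n = suc n} f with f zero | ∃⊎∀ (f ∘ suc)
... | inj₁ p | _            = inj₁ (zero , p)
... | inj₂ _ | inj₁ (j , p) = inj₁ (suc j , p)
... | inj₂ q | inj₂ h       = inj₂ λ { zero → q ; (suc j) → h j }

-- The difference of the two sides is (e - 1)² + 1. Splitting off e = 0 and e = 1 shifts the square
-- to (e + 1)², which avoids subtraction.
n²-bound : ∀ e → 5 ℕ.* e < suc (suc e) ℕ.* suc e
n²-bound zero          = s≤s z≤n
n²-bound (suc zero)    = ℕ.≤-refl
n²-bound (suc (suc e)) = subst (5 ℕ.* suc (suc e) <_)
  (solve 1 (λ e → con 11 :+ con 5 :* e :+ (con 1 :+ con 2 :* e :+ e :* e)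
      := (con 4 :+ e) :* (con 3 :+ e)) refl e)
  (ℕ.≤-trans (ℕ.≤-reflexive
      (solve 1 (λ e → con 1 :+ con 5 :* (con 2 :+ e) := con 11 :+ con 5 :* e) refl e))
    (ℕ.m≤m+n _ _))
  where open Data.Nat.Solver.+-*-Solver

hexagon : ∀ {n} → Fin n → Fin n → Fin n → Vec (Fin n × Fin n) 6
hexagon p q r = (p , q) ∷ (q , p) ∷ (p , r) ∷ (r , p) ∷ (q , r) ∷ (r , q) ∷ []

module Intersecting {a n} {C : Fin n → Fin n → Set a}
  (C? : ∀ x y → Dec (C x y))
  (irreflexive : ∀ {x y} → C x y → x ≢ y)
  (intersecting : ∀ {x y x′ y′} → C x y → C x′ y′ → (x ∈₂ x′ , y′) ⊎ (y ∈₂ x′ , y′))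
  where

  Star : Fin n → Set a
  Star i = ∀ {x y} → C x y → i ∈₂ x , y

  Avoids : Fin n → Set a
  Avoids i = ∃ λ x → ∃ λ y → C x y × i ≢ x × i ≢ y

  star⊎avoids : ∀ i → Star i ⊎ Avoids i
  star⊎avoids i
    with any? (λ x → any? λ y → C? x y ×-dec ¬? (i ≟ x) ×-dec ¬? (i ≟ y))
  ... | yes h = inj₂ h
  ... | no ¬h = inj₁ star
    where
    star : Star i
    star {x} {y} c with i ≟ x | i ≟ y
    ... | yes p | _     = inj₁ p
    ... | _     | yes q = inj₂ q
    ... | no p  | no q  = contradiction (x , y , c , p , q) ¬h

  Triangle : Set a
  Triangle = ∃ λ p → ∃ λ q → ∃ λ r → (p ≢ q × r ≢ p × r ≢ q) ×
    ∀ {x y} → C x y → ∃ λ k → lookup (hexagon p q r) k ≡ (x , y)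

  -- Whichever of p and q the pair contains, the side opposite to it supplies a second corner; the
  -- order of the two corners selects the entry of `hexagon`.
  triangle : ∀ {p q r} → p ≢ q → r ≢ p → r ≢ q →
    (∀ {x y} → C x y → (p ∈₂ x , y) ⊎ (q ∈₂ x , y)) →
    (∀ {x y} → C x y → (q ∈₂ x , y) ⊎ (r ∈₂ x , y)) →
    (∀ {x y} → C x y → (p ∈₂ x , y) ⊎ (r ∈₂ x , y)) →
    ∀ {x y} → C x y → ∃ λ k → lookup (hexagon p q r) k ≡ (x , y)
  triangle p≢q r≢p r≢q pq qr pr c with pq c | qr c | pr c
  ... | inj₁ (inj₁ refl) | inj₁ (inj₁ refl) | _ = contradiction refl p≢q
  ... | inj₁ (inj₁ refl) | inj₁ (inj₂ refl) | _ = 0F , refl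
  ... | inj₁ (inj₁ refl) | inj₂ (inj₁ refl) | _ = contradiction refl r≢p
  ... | inj₁ (inj₁ refl) | inj₂ (inj₂ refl) | _ = 2F , refl
  ... | inj₁ (inj₂ refl) | inj₁ (inj₁ refl) | _ = 1F , refl
  ... | inj₁ (inj₂ refl) | inj₁ (inj₂ refl) | _ = contradiction refl p≢q
  ... | inj₁ (inj₂ refl) | inj₂ (inj₁ refl) | _ = 3F , refl
  ... | inj₁ (inj₂ refl) | inj₂ (inj₂ refl) | _ = contradiction refl r≢p
  ... | inj₂ (inj₁ refl) | _ | inj₁ (inj₁ refl) = contradiction refl p≢q
  ... | inj₂ (inj₁ refl) | _ | inj₁ (inj₂ refl) = 1F , refl
  ... | inj₂ (inj₁ refl) | _ | inj₂ (inj₁ refl) = contradiction refl r≢q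
  ... | inj₂ (inj₁ refl) | _ | inj₂ (inj₂ refl) = 4F , refl
  ... | inj₂ (inj₂ refl) | _ | inj₁ (inj₁ refl) = 0F , refl
  ... | inj₂ (inj₂ refl) | _ | inj₁ (inj₂ refl) = contradiction refl p≢q
  ... | inj₂ (inj₂ refl) | _ | inj₂ (inj₁ refl) = 5F , refl
  ... | inj₂ (inj₂ refl) | _ | inj₂ (inj₂ refl) = contradiction refl r≢q

  Edge : Fin n → Fin n → Set a
  Edge x y = C x y ⊎ C y x

  edge-intersects : ∀ {x y} → Edge x y →
    ∀ {x′ y′} → C x′ y′ → (x ∈₂ x′ , y′) ⊎ (y ∈₂ x′ , y′)
  edge-intersects (inj₁ c) c′ = intersecting c c′
  edge-intersects (inj₂ c) c′ = swap (intersecting c c′)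

  edge-irreflexive : ∀ {x y} → Edge x y → x ≢ y
  edge-irreflexive (inj₁ c) = irreflexive c
  edge-irreflexive (inj₂ c) = irreflexive c ∘ sym

  -- The member that avoids p can meet {p,q} only in q, so its other end is the new corner.
  extend : ∀ {p q} → Edge p q → Avoids p → ∃ λ r → r ≢ p × Edge q r
  extend e (x , y , c , p≢x , p≢y) with edge-intersects e c
  ... | inj₁ (inj₁ p≡x)  = contradiction p≡x p≢x
  ... | inj₁ (inj₂ p≡y)  = contradiction p≡y p≢y
  ... | inj₂ (inj₁ refl) = y , p≢y ∘ sym , inj₁ c
  ... | inj₂ (inj₂ refl) = x , p≢x ∘ sym , inj₂ c

  -- A member avoiding q meets {p,q} in p and {q,r} in r, so it joins p and r.
  close : ∀ {p q r} → r ≢ p → Edge p q → Edge q r → Avoids q → Edge p r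
  close r≢p e e′ (x , y , c , q≢x , q≢y)
    with edge-intersects e c | edge-intersects e′ c
  ... | inj₂ (inj₁ q≡x)  | _                = contradiction q≡x q≢x
  ... | inj₂ (inj₂ q≡y)  | _                = contradiction q≡y q≢y
  ... | inj₁ _           | inj₁ (inj₁ q≡x)  = contradiction q≡x q≢x
  ... | inj₁ _           | inj₁ (inj₂ q≡y)  = contradiction q≡y q≢y
  ... | inj₁ (inj₁ refl) | inj₂ (inj₁ refl) = contradiction refl r≢p
  ... | inj₁ (inj₁ refl) | inj₂ (inj₂ refl) = inj₁ c
  ... | inj₁ (inj₂ refl) | inj₂ (inj₁ refl) = inj₂ c
  ... | inj₁ (inj₂ refl) | inj₂ (inj₂ refl) = contradiction refl r≢p

  -- With {p,q}, {q,r} and {p,r} in the family, every member contains two of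
  -- p, q, r.
  star⊎triangle : Fin n → ∃ Star ⊎ Triangle
  star⊎triangle i with star⊎avoids i
  ... | inj₁ s = inj₁ (i , s)
  ... | inj₂ (p , q , pq , _) with star⊎avoids p | star⊎avoids q
  ...   | inj₁ s  | _       = inj₁ (p , s)
  ...   | inj₂ _  | inj₁ s  = inj₁ (q , s)
  ...   | inj₂ ap | inj₂ aq with extend (inj₁ pq) ap
  ...     | r , r≢p , e = inj₂ (p , q , r ,
    (irreflexive pq , r≢p , edge-irreflexive e ∘ sym) ,
    triangle (irreflexive pq) r≢p (edge-irreflexive e ∘ sym)
      (intersecting pq) (edge-intersects e)
      (edge-intersects (close r≢p (inj₁ pq) e aq)))

-- A first entry and one of the n other elements, reached through `punchIn`, encode an ordered pair.
-- Sending a pair to a place where it is listed is injective.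
listedPairs⇒≤ : ∀ {d e n} (w : Fin d → Fin e → Fin (suc n) × Fin (suc n)) →
  (∀ {x y} → x ≢ y → ∃ λ j → ∃ λ l → w j l ≡ (x , y)) →
  suc n ℕ.* n ≤ d ℕ.* e
listedPairs⇒≤ {d} {e} {n} w listed = injective⇒≤ {f = code} code-injective
  where
  pair : Fin ((suc n) ℕ.* n) → Fin (suc n) × Fin (suc n)
  pair k = let i , k′ = remQuot {suc n} n k in i , punchIn i k′

  pair-injective : ∀ {k k′} → pair k ≡ pair k′ → k ≡ k′
  pair-injective {k} {k′} eq = begin
    k                       ≡⟨ combine-remQuot {suc n} n k ⟨
    combine i x             ≡⟨ cong₂ combine i≡i′ x≡x′ ⟩
    combine i′ x′           ≡⟨ combine-remQuot {suc n} n k′ ⟩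
    k′                      ∎
    where
    open ≡-Reasoning
    i i′ : Fin (suc n)
    x x′ : Fin n
    i  = proj₁ (remQuot {suc n} n k)
    x  = proj₂ (remQuot {suc n} n k)
    i′ = proj₁ (remQuot {suc n} n k′)
    x′ = proj₂ (remQuot {suc n} n k′)
    i≡i′ : i ≡ i′
    i≡i′ = ,-injectiveˡ eq
    x≡x′ : x ≡ x′
    x≡x′ = punchIn-injective i x x′
      (≡.trans (,-injectiveʳ eq) (cong (λ z → punchIn z x′) (sym i≡i′)))

  position : ∀ k → ∃ λ j → ∃ λ l → w j l ≡ pair k
  position k = listed (punchInᵢ≢i _ _ ∘ sym)

  code : Fin (suc n ℕ.* n) → Fin (d ℕ.* e)
  code k = combine (proj₁ (position k)) (proj₁ (proj₂ (position k)))

  code-injective : ∀ {k k′} → code k ≡ code k′ → k ≡ k′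
  code-injective {k} {k′} eq = pair-injective (≡.trans (sym (proj₂ (proj₂ (position k))))
    (≡.trans (cong₂ w (proj₁ eqs) (proj₂ eqs)) (proj₂ (proj₂ (position k′)))))
    where
    eqs : proj₁ (position k) ≡ proj₁ (position k′) ×
      proj₁ (proj₂ (position k)) ≡ proj₁ (proj₂ (position k′))
    eqs = combine-injective _ _ _ _ eq

-- If there are only n ∸ 2 colours, then deleting a star together with its
-- colour keeps this bound, so we may assume that all colour classes live on
-- triangles; since they contain at most five of the six ordered pairs of their
-- triangle, n (n ∸ 1) ≤ 5 (n ∸ 2), which is impossible.
pairCover⇒≤ : ∀ {a} d n (C : Fin d → Fin n → Fin n → Set a) →
  (∀ j x y → Dec (C j x y)) →
  (∀ {j x y} → C j x y → x ≢ y) →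
  (∀ {j x y x′ y′} → C j x y → C j x′ y′ → (x ∈₂ x′ , y′) ⊎ (y ∈₂ x′ , y′)) →
  (∀ j p q r → p ≢ q → r ≢ p → r ≢ q →
    ¬ (∀ k → uncurry (C j) (lookup (hexagon p q r) k))) →
  (∀ {x y} → x ≢ y → ∃ λ j → C j x y) →
  n ≤ suc d
pairCover⇒≤ d zero _ _ _ _ _ _ = z≤n
pairCover⇒≤ d (suc zero) _ _ _ _ _ _ = s≤s z≤n
pairCover⇒≤ zero (suc (suc n)) C _ _ _ _ cover with cover {zero} {suc zero} (λ ())
... | () , _
pairCover⇒≤ {a} (suc d) (suc (suc n)) C C? irr int hex cover
  with ∃⊎∀ (λ j → Intersecting.star⊎triangle (C? j) irr int zero)
... | inj₁ (j , i , star) = s≤s (pairCover⇒≤ d (suc n)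
    (λ j′ x y → C (punchIn j j′) (punchIn i x) (punchIn i y))
    (λ _ _ _ → C? _ _ _)
    (λ c → irr c ∘ cong (punchIn i))
    (λ c c′ → Sum.map (Sum.map (punchIn-injective i _ _) (punchIn-injective i _ _))
      (Sum.map (punchIn-injective i _ _) (punchIn-injective i _ _)) (int c c′))
    (λ j′ p q r p≢q r≢p r≢q h → hex (punchIn j j′) _ _ _
      (p≢q ∘ punchIn-injective i _ _) (r≢p ∘ punchIn-injective i _ _)
      (r≢q ∘ punchIn-injective i _ _)
      -- Applying `punchIn i` to the entries commutes with `lookup` definitionally only at a
      -- concrete position.
      λ { zero → h (0F) ; (suc zero) → h (1F) ; (suc (suc zero)) → h (2F)
        ; (suc (suc (suc zero))) → h (3F) ; (suc (suc (suc (suc zero)))) → h (4F)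
        ; (suc (suc (suc (suc (suc zero))))) → h (5F) })
    cover′)
  where
  cover′ : ∀ {x y} → x ≢ y → ∃ λ j′ → C (punchIn j j′) (punchIn i x) (punchIn i y)
  cover′ {x} {y} x≢y with cover {punchIn i x} {punchIn i y} (x≢y ∘ punchIn-injective i _ _)
  ... | j′ , c with j ≟ j′
  ...   | no j≢j′ = punchOut j≢j′ ,
    subst (λ k → C k (punchIn i x) (punchIn i y)) (sym (punchIn-punchOut j≢j′)) c
  ...   | yes refl with star c
  ...     | inj₁ i≡x = contradiction (sym i≡x) (punchInᵢ≢i i x)
  ...     | inj₂ i≡y = contradiction (sym i≡y) (punchInᵢ≢i i y)
... | inj₂ triangles with suc (suc n) ℕ.≤? suc (suc d)
...   | yes n≤d = n≤d
-- Failure of the bound means `suc d ≤ n`, and with five pairs per colour this gives (n + 2)(n + 1)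
-- ≤ 5n.
...   | no n≰d = contradiction
    (listedPairs⇒≤ (proj₁ ∘ five) λ x≢y → let j , c = cover x≢y in j , proj₂ (five j) c)
    (ℕ.<⇒≱ (ℕ.≤-<-trans
      (ℕ.≤-trans (ℕ.*-monoˡ-≤ 5 (ℕ.≤-pred (ℕ.≤-pred (ℕ.≰⇒> n≰d))))
        (ℕ.≤-reflexive (ℕ.*-comm n 5)))
      (n²-bound n)))
  where
  five : ∀ j → ∃ λ (w : Fin 5 → Fin (2 ℕ.+ n) × Fin (2 ℕ.+ n)) →
    ∀ {x y} → C j x y → ∃ λ k → w k ≡ (x , y)
  five j with triangles j
  ... | p , q , r , (p≢q , r≢p , r≢q) , h
    -- Some entry of the hexagon lies outside the class; skipping it leaves a list of five that
    -- still contains the class.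
    with k₀ , ¬c ← ¬∀⟶∃¬ 6 _ (λ k → uncurry (C? j) (lookup (hexagon p q r) k))
      (hex j p q r p≢q r≢p r≢q)
    = lookup (hexagon p q r) ∘ punchIn k₀ , listed
    where
    listed : ∀ {x y} → C j x y → ∃ λ k → lookup (hexagon p q r) (punchIn k₀ k) ≡ (x , y)
    listed c with h c
    ... | k , eq = punchOut k₀≢k ,
      ≡.trans (cong (lookup (hexagon p q r)) (punchIn-punchOut k₀≢k)) eq
      where
      k₀≢k : k₀ ≢ k
      k₀≢k refl = ¬c (subst (uncurry (C j)) (sym eq) c)


-- Rational and natural numbers as Dedekind cuts.

fromℚ : ℚ → ℝ
fromℚ q = record
  { L = ℚ._< q
  ; U = q ℚ.<_
  ; L-inhabited = q ℚ.- ℚ.1ℚ , q-1<q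
  ; U-inhabited = q ℚ.+ ℚ.1ℚ , q<q+1
  ; L-rounded = λ r → mk⇔
      (λ r<q → let s , r<s , s<q = ℚ.<-dense r<q in s , r<s , s<q)
      (λ (s , r<s , s<q) → ℚ.<-trans r<s s<q)
  ; U-rounded = λ r → mk⇔
      (λ q<r → let s , q<s , s<r = ℚ.<-dense q<r in s , s<r , q<s)
      (λ (s , s<r , q<s) → ℚ.<-trans q<s s<r)
  ; disjoint = λ r (r<q , q<r) → ℚ.<-asym r<q q<r
  ; located = located
  }
  where
  q<q+1 : q ℚ.< q ℚ.+ ℚ.1ℚ
  q<q+1 = subst (ℚ._< q ℚ.+ ℚ.1ℚ) (ℚ.+-identityʳ q) (ℚ.+-monoʳ-< q (ℚ.positive⁻¹ ℚ.1ℚ))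
  q-1<q : q ℚ.- ℚ.1ℚ ℚ.< q
  q-1<q = subst (q ℚ.- ℚ.1ℚ ℚ.<_) (ℚ.+-identityʳ q) (ℚ.+-monoʳ-< q (ℚ.negative⁻¹ (ℚ.- ℚ.1ℚ)))
  located : ∀ r s → r ℚ.< s → r ℚ.< q ⊎ q ℚ.< s
  located r s r<s with r ℚ.<? q
  ... | yes r<q = inj₁ r<q
  ... | no  r≮q = inj₂ (ℚ.≤-<-trans (ℚ.≮⇒≥ r≮q) r<s)

fromℚ-mono : ∀ {q r} → q ℚ.≤ r → fromℚ q ≤ᴿ fromℚ r
fromℚ-mono q≤r s<q = ℚ.<-≤-trans s<q q≤r

fromℚ-cancel : ∀ {q r} → fromℚ q ≤ᴿ fromℚ r → q ℚ.≤ r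
fromℚ-cancel q≤r = ℚ.≮⇒≥ λ r<q →
  let _ , r<s , s<q = ℚ.<-dense r<q in ℚ.<-asym r<s (q≤r s<q)

fromℕ : ℕ → ℚ
fromℕ zero    = ℚ.0ℚ
fromℕ (suc n) = ℚ.1ℚ ℚ.+ fromℕ n

fromℕ-mono : ∀ {m n} → m ≤ n → fromℕ m ℚ.≤ fromℕ n
fromℕ-mono {n = zero}  z≤n     = ℚ.≤-refl
fromℕ-mono {n = suc n} z≤n     = subst (ℚ._≤ ℚ.1ℚ ℚ.+ fromℕ n) (ℚ.+-identityˡ ℚ.0ℚ)
  (ℚ.+-mono-≤ (ℚ.<⇒≤ (ℚ.positive⁻¹ ℚ.1ℚ)) (fromℕ-mono {n = n} z≤n))
fromℕ-mono             (s≤s h) = ℚ.+-monoʳ-≤ ℚ.1ℚ (fromℕ-mono h)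

fromℕ-mono-< : ∀ {m n} → m < n → fromℕ m ℚ.< fromℕ n
fromℕ-mono-< {m} h = ℚ.<-≤-trans
  (subst (ℚ._< ℚ.1ℚ ℚ.+ fromℕ m) (ℚ.+-identityˡ (fromℕ m))
    (ℚ.+-monoˡ-< (fromℕ m) (ℚ.positive⁻¹ ℚ.1ℚ)))
  (fromℕ-mono h)

fromℕ-cancel : ∀ {m n} → fromℕ m ℚ.≤ fromℕ n → m ≤ n
fromℕ-cancel h = ℕ.≮⇒≥ λ n<m → ℚ.<-irrefl refl (ℚ.<-≤-trans (fromℕ-mono-< n<m) h)

-- Closed intervals with integer ends, and shapes.

[_⋯_]⟨_⟩ : ∀ m n → m ≤ n → Interval
[ m ⋯ n ]⟨ m≤n ⟩ = record
  { lo    = fromℚ (fromℕ m)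
  ; hi    = fromℚ (fromℕ n)
  ; lo≤hi = fromℚ-mono (fromℕ-mono m≤n)
  }

-- The larger of the two lower ends is a common point. Conversely, a common point lies between each
-- lower end and the other upper end.
meets⇔ : ∀ {m n m′ n′} (m≤n : m ≤ n) (m′≤n′ : m′ ≤ n′) →
  (m ≤ n′ × m′ ≤ n) ⇔ ([ m ⋯ n ]⟨ m≤n ⟩ Meets [ m′ ⋯ n′ ]⟨ m′≤n′ ⟩)
meets⇔ {m} {n} {m′} {n′} m≤n m′≤n′ = mk⇔ to from
  where
  real-mono : ∀ {i j} → i ≤ j → fromℚ (fromℕ i) ≤ᴿ fromℚ (fromℕ j)
  real-mono i≤j = fromℚ-mono (fromℕ-mono i≤j)
  to : m ≤ n′ × m′ ≤ n → [ m ⋯ n ]⟨ m≤n ⟩ Meets [ m′ ⋯ n′ ]⟨ m′≤n′ ⟩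
  to (m≤n′ , m′≤n) with ℕ.≤-total m m′
  ... | inj₁ m≤m′ = fromℚ (fromℕ m′) ,
    (real-mono m≤m′ , real-mono {m′} {n} m′≤n) , (real-mono {m′} ℕ.≤-refl , real-mono m′≤n′)
  ... | inj₂ m′≤m = fromℚ (fromℕ m) ,
    (real-mono {m} ℕ.≤-refl , real-mono m≤n) , (real-mono m′≤m , real-mono m≤n′)
  from : [ m ⋯ n ]⟨ m≤n ⟩ Meets [ m′ ⋯ n′ ]⟨ m′≤n′ ⟩ → m ≤ n′ × m′ ≤ n
  from (x , (lo≤x , x≤hi) , (lo′≤x , x≤hi′)) =
    fromℕ-cancel (fromℚ-cancel λ q → x≤hi′ (lo≤x q)) ,
    fromℕ-cancel (fromℚ-cancel λ q → x≤hi (lo′≤x q))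

-- A range l k stands for the integers from l to l + k; points are perturbed so
-- that the points of distinct vertices never coincide.
data Shape : Set where
  point : ℕ → Shape
  range : ℕ → ℕ → Shape

Compatible : Shape → Shape → Set
Compatible (point _)   (point _)   = ⊥
Compatible (point b)   (range l k) = l ≤ b × b ≤ l ℕ.+ k
Compatible (range l k) (point b)   = l ≤ b × b ≤ l ℕ.+ k
Compatible (range l k) (range i j) = l ≤ i ℕ.+ j × i ≤ l ℕ.+ k

module _ (N : ℕ) where

  -- For o ≤ N the order is lexicographic: o is a last digit in base `suc N`, a perturbation too
  -- small to reach the next value of b.
  position : ℕ → ℕ → ℕ
  position b o = b ℕ.* suc N ℕ.+ o

  position-mono : ∀ {b b′ o o′} → b ≤ b′ → o ≤ o′ → position b o ≤ position b′ o′
  position-mono b≤b′ = ℕ.+-mono-≤ (ℕ.*-monoˡ-≤ (suc N) b≤b′)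

  position-cancelˡ : ∀ {b b′ o o′} → o′ ≤ N → position b o ≤ position b′ o′ → b ≤ b′
  position-cancelˡ {b} {b′} {o} {o′} o′≤N h = ℕ.≮⇒≥ λ b′<b → ℕ.<⇒≱
    (ℕ.<-≤-trans
      (subst (position b′ o′ <_) (ℕ.+-comm (b′ ℕ.* suc N) (suc N))
        (ℕ.+-monoʳ-< (b′ ℕ.* suc N) (s≤s o′≤N)))
      (ℕ.≤-trans (ℕ.*-monoˡ-≤ (suc N) b′<b) (ℕ.m≤m+n _ o)))
    h

  -- The extreme offsets 0 and N at its ends make a range contain every perturbation of the points
  -- from l to l + k.
  lower upper : Shape → ℕ → ℕ
  lower (point b)   o = position b o
  lower (range l k) o = position l 0
  upper (point b)   o = position b o
  upper (range l k) o = position (l ℕ.+ k) N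

  lower≤upper : ∀ s o → lower s o ≤ upper s o
  lower≤upper (point b)   o = ℕ.≤-refl
  lower≤upper (range l k) o = position-mono (ℕ.m≤m+n l k) z≤n

  overlap⇔compatible : ∀ s s′ {o o′} → o ≤ N → o′ ≤ N → o ≢ o′ →
    (lower s o ≤ upper s′ o′ × lower s′ o′ ≤ upper s o) ⇔ Compatible s s′
  overlap⇔compatible (point b) (point b′) {o} {o′} o≤N o′≤N o≢o′ = mk⇔ coincide λ ()
    where
    coincide : position b o ≤ position b′ o′ × position b′ o′ ≤ position b o → ⊥
    coincide (h , h′) with refl ← ℕ.≤-antisym (position-cancelˡ {b} {b′} {o} o′≤N h)
                                      (position-cancelˡ {b′} {b} {o′} o≤N h′) =
      o≢o′ (ℕ.+-cancelˡ-≡ (b ℕ.* suc N) o o′ (ℕ.≤-antisym h h′))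
  overlap⇔compatible (point b) (range l k) {o} o≤N _ _ = mk⇔
    (λ (h , h′) → position-cancelˡ {o = 0} o≤N h′ , position-cancelˡ {o = o} ℕ.≤-refl h)
    (λ (h , h′) → position-mono h′ o≤N , position-mono h z≤n)
  overlap⇔compatible (range l k) (point b) {o′ = o} _ o≤N _ = mk⇔
    (λ (h , h′) → position-cancelˡ {o = 0} o≤N h , position-cancelˡ {o = o} ℕ.≤-refl h′)
    (λ (h , h′) → position-mono h z≤n , position-mono h′ o≤N)
  overlap⇔compatible (range l k) (range i j) _ _ _ = mk⇔
    (λ (h , h′) → position-cancelˡ {o = 0} ℕ.≤-refl h , position-cancelˡ {o = 0} ℕ.≤-refl h′)
    (λ (h , h′) → position-mono h z≤n , position-mono h′ z≤n)

-- Interval graphs from shapes.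

module _ {a} {V : Setoid a a} (G : SimpleGraph V a) where
  open Setoid V using (Carrier; _≈_; _≉_) renaming (sym to ≈-sym; trans to ≈-trans)
  open SimpleGraph

  -- The number `index x` is the perturbation of x, so distinct vertices receive distinct offsets.
  -- Adjacency in `I j` includes `x ≉ y` because every interval overlaps itself.
  shapes⇒intersection : ∀ {N d} (index : Carrier → Fin N) →
    (∀ {x y} → x ≈ y → index x ≡ index y) →
    (∀ {x y} → index x ≡ index y → x ≈ y) →
    (shape : Fin d → Carrier → Shape) →
    (∀ j {x y} → x ≈ y → shape j x ≡ shape j y) →
    (∀ {x y} → x ≉ y → Adj G x y ⇔ (∀ j → Compatible (shape j x) (shape j y))) →
    IsIntersectionOfIntervalGraphs G d
  shapes⇒intersection {N} {d} index index-cong index-injective shape shape-cong adj⇔ =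
    I , I-interval , λ x≉y → mk⇔
      (λ xy j → x≉y , from (overlap⇔ j x≉y) (to (adj⇔ x≉y) xy j))
      (λ h → from (adj⇔ x≉y) λ j → to (overlap⇔ j x≉y) (proj₂ (h j)))
    where
    open Equivalence
    low high : Fin d → Carrier → ℕ
    low  j x = lower N (shape j x) (toℕ (index x))
    high j x = upper N (shape j x) (toℕ (index x))
    low-cong : ∀ j {x y} → x ≈ y → low j x ≡ low j y
    low-cong j x≈y = cong₂ (lower N) (shape-cong j x≈y) (cong toℕ (index-cong x≈y))
    high-cong : ∀ j {x y} → x ≈ y → high j x ≡ high j y
    high-cong j x≈y = cong₂ (upper N) (shape-cong j x≈y) (cong toℕ (index-cong x≈y))
    Overlap : Fin d → Carrier → Carrier → Set
    Overlap j x y = low j x ≤ high j y × low j y ≤ high j x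
    overlap⇔ : ∀ j {x y} → x ≉ y → Overlap j x y ⇔ Compatible (shape j x) (shape j y)
    overlap⇔ j {x} {y} x≉y = overlap⇔compatible N (shape j x) (shape j y)
      (ℕ.<⇒≤ (toℕ<n (index x))) (ℕ.<⇒≤ (toℕ<n (index y))) (x≉y ∘ index-injective ∘ toℕ-injective)
    I : Fin d → SimpleGraph V a
    I j = record
      { Adj        = λ x y → x ≉ y × Overlap j x y
      ; adj-resp   =
          (λ y≈y′ (x≉y , h , h′) → (λ x≈y′ → x≉y (≈-trans x≈y′ (≈-sym y≈y′))) ,
            subst (low j _ ≤_) (high-cong j y≈y′) h , subst (_≤ high j _) (low-cong j y≈y′) h′) ,
          (λ x≈x′ (x≉y , h , h′) → (λ x′≈y → x≉y (≈-trans x≈x′ x′≈y)) ,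
            subst (_≤ high j _) (low-cong j x≈x′) h , subst (low j _ ≤_) (high-cong j x≈x′) h′)
      ; adj-sym    = λ (x≉y , h , h′) → (λ y≈x → x≉y (≈-sym y≈x)) , h′ , h
      ; adj-irrefl = λ x≈y (x≉y , _) → x≉y x≈y
      }
    ordered : ∀ j x → low j x ≤ high j x
    ordered j x = lower≤upper N (shape j x) (toℕ (index x))
    reflexiveᴿ : ∀ {m n} → m ≡ n → fromℚ (fromℕ m) ≈ᴿ fromℚ (fromℕ n)
    reflexiveᴿ refl = (λ z → z) , (λ z → z)
    I-interval : ∀ j → IsIntervalGraph (I j)
    I-interval j = record
      { interval      = λ x → [ low j x ⋯ high j x ]⟨ ordered j x ⟩
      ; interval-cong = λ x≈y → reflexiveᴿ (low-cong j x≈y) , reflexiveᴿ (high-cong j x≈y)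
      ; adj⇔meets     = λ {x} {y} x≉y → mk⇔
          (λ (_ , h) → to (meets⇔ (ordered j x) (ordered j y)) h)
          (λ h → x≉y , from (meets⇔ (ordered j x) (ordered j y)) h)
      }

-- Shapes for conditions on exponents.

levelShape : ℕ → ℕ → Shape
levelShape m e with e ℕ.+ e ℕ.<? m
... | yes _ = point (m ∸ e)
... | no _  = range 0 e

-- Two exponents below m/2 have sum below m; two exponents of at least m/2 have sum at least m, and
-- both ranges contain 0. In the mixed case `m ∸ e ≤ f` is the condition itself.
levelShape-compatible : ∀ m e f → Compatible (levelShape m e) (levelShape m f) ⇔ m ≤ e ℕ.+ f
levelShape-compatible m e f with e ℕ.+ e ℕ.<? m | f ℕ.+ f ℕ.<? m
... | yes 2e<m | yes 2f<m = mk⇔ (λ ()) λ m≤e+f → ℕ.<⇒≱ (sum<m (ℕ.≤-total e f)) m≤e+f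
  where
  sum<m : e ≤ f ⊎ f ≤ e → e ℕ.+ f < m
  sum<m (inj₁ e≤f) = ℕ.≤-<-trans (ℕ.+-monoˡ-≤ f e≤f) 2f<m
  sum<m (inj₂ f≤e) = ℕ.≤-<-trans (ℕ.+-monoʳ-≤ e f≤e) 2e<m
... | yes _    | no _     = mk⇔ (λ (_ , h) → ℕ.≤-trans (ℕ.m≤n+m∸n m e) (ℕ.+-monoʳ-≤ e h))
  (λ h → z≤n , ℕ.m≤n+o⇒m∸n≤o m e h)
... | no _     | yes _    = mk⇔
  (λ (_ , h) → subst (m ≤_) (ℕ.+-comm f e)
    (ℕ.≤-trans (ℕ.m≤n+m∸n m f) (ℕ.+-monoʳ-≤ f h)))
  (λ h → z≤n , ℕ.m≤n+o⇒m∸n≤o m f (subst (m ≤_) (ℕ.+-comm e f) h))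
... | no 2e≮m  | no 2f≮m  = mk⇔ (λ _ → m≤sum (ℕ.≤-total e f)) (λ _ → z≤n , z≤n)
  where
  m≤sum : e ≤ f ⊎ f ≤ e → m ≤ e ℕ.+ f
  m≤sum (inj₁ e≤f) = ℕ.≤-trans (ℕ.≮⇒≥ 2e≮m) (ℕ.+-monoʳ-≤ e e≤f)
  m≤sum (inj₂ f≤e) = ℕ.≤-trans (ℕ.≮⇒≥ 2f≮m) (ℕ.+-monoˡ-≤ f f≤e)

-- The first argument is an exponent rescaled to the range 0, 1, 2; the second is
-- the exponent at the prime that has no interval graph of its own.
rankShape : ℕ → ℕ → Shape
rankShape 0             0       = point 0
rankShape 1             0       = point 1
rankShape (suc (suc _)) 0       = range 2 1
rankShape 0             (suc _) = point 3
rankShape 1             (suc _) = range 1 1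
rankShape (suc (suc _)) (suc _) = range 0 3

-- The first factor is the condition at the prime of the graph. The second is the condition at the
-- merged prime, waived for two full ranks, whose ranges always meet.
RanksMeet : ℕ → ℕ → ℕ → ℕ → Set
RanksMeet r s w w′ = 2 ≤ r ℕ.+ s × (1 ≤ w ℕ.+ w′ ⊎ (2 ≤ r × 2 ≤ s))

compatible? : ∀ s s′ → Dec (Compatible s s′)
compatible? (point _)   (point _)   = no λ ()
compatible? (point b)   (range l k) = (l ℕ.≤? b) ×-dec (b ℕ.≤? l ℕ.+ k)
compatible? (range l k) (point b)   = (l ℕ.≤? b) ×-dec (b ℕ.≤? l ℕ.+ k)
compatible? (range l k) (range i j) = (l ℕ.≤? i ℕ.+ j) ×-dec (i ℕ.≤? l ℕ.+ k)

-- The bounds leave 3 · 3 · 2 · 2 cases, which are settled by evaluating a decision procedure.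
rankShape-compatible : ∀ {r s w w′} → r ≤ 2 → s ≤ 2 → w ≤ 1 → w′ ≤ 1 →
  Compatible (rankShape r w) (rankShape s w′) ⇔ RanksMeet r s w w′
rankShape-compatible {r} {s} {w} {w′} r≤2 s≤2 w≤1 w′≤1 =
  mk⇔ (proj₁ implications) (proj₂ implications)
  where
  Implications : ℕ → ℕ → ℕ → ℕ → Set
  Implications r s w w′ =
    (Compatible (rankShape r w) (rankShape s w′) → RanksMeet r s w w′) ×
    (RanksMeet r s w w′ → Compatible (rankShape r w) (rankShape s w′))
  implications? : ∀ r s w w′ → Dec (Implications r s w w′)
  implications? r s w w′ = (compat →-dec meet) ×-dec (meet →-dec compat)
    where
    compat = compatible? (rankShape r w) (rankShape s w′)
    meet = (2 ℕ.≤? r ℕ.+ s) ×-dec ((1 ℕ.≤? w ℕ.+ w′) ⊎-dec ((2 ℕ.≤? r) ×-dec (2 ℕ.≤? s)))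
  checked : ∀ (r s : Fin 3) (w w′ : Fin 2) → Implications (toℕ r) (toℕ s) (toℕ w) (toℕ w′)
  checked = from-yes checked?
    where
    checked? : Dec (∀ (r s : Fin 3) (w w′ : Fin 2) → Implications (toℕ r) (toℕ s) (toℕ w) (toℕ w′))
    checked? = all? {n = 3} λ r → all? {n = 3} λ s → all? {n = 2} λ w → all? {n = 2} λ w′ →
      implications? (toℕ r) (toℕ s) (toℕ w) (toℕ w′)
  implications : Implications r s w w′
  implications
    with h ← checked (fromℕ< (s≤s r≤2)) (fromℕ< (s≤s s≤2))
                     (fromℕ< (s≤s w≤1)) (fromℕ< (s≤s w′≤1))
    rewrite toℕ-fromℕ< (s≤s r≤2) | toℕ-fromℕ< (s≤s s≤2)
          | toℕ-fromℕ< (s≤s w≤1) | toℕ-fromℕ< (s≤s w′≤1) = h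

-- Doubling for m = 1 puts both the full exponent and the threshold for a sum at 2 in either case.
rank : ∀ {m} → m ≡ 1 ⊎ m ≡ 2 → ℕ → ℕ
rank (inj₁ _) v = v ℕ.+ v
rank (inj₂ _) v = v

rank-≤ : ∀ {m v} (h : m ≡ 1 ⊎ m ≡ 2) → v ≤ m → rank h v ≤ 2
rank-≤ (inj₁ refl) v≤1 = ℕ.+-mono-≤ v≤1 v≤1
rank-≤ (inj₂ refl) v≤2 = v≤2

rank-+⇔ : ∀ {m v w} (h : m ≡ 1 ⊎ m ≡ 2) → 2 ≤ rank h v ℕ.+ rank h w ⇔ m ≤ v ℕ.+ w
rank-+⇔ (inj₂ refl) = mk⇔ (λ h → h) (λ h → h)
rank-+⇔ {v = suc v} {w} (inj₁ refl) = mk⇔ (λ _ → s≤s z≤n)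
  (λ _ → ℕ.≤-trans (s≤s (subst (1 ≤_) (sym (ℕ.+-suc v v)) (s≤s z≤n))) (ℕ.m≤m+n _ _))
rank-+⇔ {v = zero} {suc w} (inj₁ refl) = mk⇔ (λ _ → s≤s z≤n)
  (λ _ → s≤s (subst (1 ≤_) (sym (ℕ.+-suc w w)) (s≤s z≤n)))
rank-+⇔ {v = zero} {zero} (inj₁ refl) = mk⇔ (λ ()) (λ ())

rank-full : ∀ {m v} (h : m ≡ 1 ⊎ m ≡ 2) → 2 ≤ rank h v → m ≤ v
rank-full {v = suc v} (inj₁ refl) _ = s≤s z≤n
rank-full             (inj₂ refl) h = h

-- Excluded middle and forbidden configurations in interval graphs.

ExcludedMiddle : ∀ a → Set (Level.suc a)
ExcludedMiddle a = (P : Set a) → Dec P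

excludedMiddle₀ : ∀ {a} → ExcludedMiddle a → ExcludedMiddle 0ℓ
excludedMiddle₀ {a} em P with em (Lift a P)
... | yes (lift p) = yes p
... | no ¬p        = no λ p → ¬p (lift p)

module LowerBounds {a} (em : ExcludedMiddle a) where

  -- If the first alternative fails, some q is in the lower cut of x but not in that of y. Then q
  -- bounds the lower cut of y, and all rationals below q are in that of x.
  ≤ᴿ-total : ∀ x y → x ≤ᴿ y ⊎ y ≤ᴿ x
  ≤ᴿ-total x y with excludedMiddle₀ em (∃ λ q → ℝ.L x q × ¬ ℝ.L y q)
  ... | no ¬h = inj₁ λ {q} q<x →
    decidable-stable (excludedMiddle₀ em (ℝ.L y q)) λ q≮y → ¬h (q , q<x , q≮y)
  ... | yes (q , q<x , q≮y) = inj₂ λ {r} r<y → below r r<y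
    where
    open Equivalence
    below : ∀ r → ℝ.L y r → ℝ.L x r
    below r r<y with ℚ.<-cmp r q
    ... | tri< r<q _    _   = from (ℝ.L-rounded x r) (q , r<q , q<x)
    ... | tri≈ _   refl _   = q<x
    ... | tri> _   _    q<r = contradiction (from (ℝ.L-rounded y q) (r , q<r , r<y)) q≮y

  ≤ᴿ-trans : ∀ x y z → x ≤ᴿ y → y ≤ᴿ z → x ≤ᴿ z
  ≤ᴿ-trans _ _ _ x≤y y≤z q<x = y≤z (x≤y q<x)

  ≰ᴿ⇒≥ᴿ : ∀ x y → ¬ (x ≤ᴿ y) → y ≤ᴿ x
  ≰ᴿ⇒≥ᴿ x y x≰y with ≤ᴿ-total x y
  ... | inj₁ x≤y = ⊥-elim (x≰y x≤y)
  ... | inj₂ y≤x = y≤x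

  _≤ᴿ?_ : ∀ x y → Dec (x ≤ᴿ y)
  x ≤ᴿ? y = excludedMiddle₀ em (x ≤ᴿ y)

  -- The failures mean y < x and y′ < x′, so y < x ≤ y′ < x′ ≤ y. The forbidden configurations below
  -- reduce to this cycle.
  crossing : ∀ x x′ y y′ → ¬ (x ≤ᴿ y) → ¬ (x′ ≤ᴿ y′) → x ≤ᴿ y′ → x′ ≤ᴿ y → ⊥
  crossing x x′ y y′ x≰y x′≰y′ x≤y′ x′≤y = x≰y
    (≤ᴿ-trans x y′ y x≤y′ (≤ᴿ-trans y′ x′ y (≰ᴿ⇒≥ᴿ x′ y′ x′≰y′) x′≤y))

  module IntervalGraph {V : Setoid a a} {I : SimpleGraph V a} (isInterval : IsIntervalGraph I) where
    open Setoid V using (Carrier; _≈_; _≉_)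
    open SimpleGraph I
    open IsIntervalGraph isInterval
    open Equivalence

    lo hi : Carrier → ℝ
    lo x = Interval.lo (interval x)
    hi x = Interval.hi (interval x)

    adj⇒≤ : ∀ {x y} → Adj x y → lo x ≤ᴿ hi y
    adj⇒≤ {x} {y} xy with to (adj⇔meets (λ x≈y → adj-irrefl x≈y xy)) xy
    ... | z , (lo≤z , _) , (_ , z≤hi) = ≤ᴿ-trans (lo x) z (hi y) lo≤z z≤hi

    ≤⇒adj : ∀ {x y} → x ≉ y → lo x ≤ᴿ hi y → lo y ≤ᴿ hi x → Adj x y
    ≤⇒adj {x} {y} x≉y x≤y y≤x with ≤ᴿ-total (lo x) (lo y)
    ... | inj₁ lo≤lo = from (adj⇔meets x≉y)
      (lo y , (lo≤lo , y≤x) , ((λ q → q) , Interval.lo≤hi (interval y)))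
    ... | inj₂ lo≤lo = from (adj⇔meets x≉y)
      (lo x , ((λ q → q) , Interval.lo≤hi (interval x)) , (lo≤lo , x≤y))

    separated : ∀ {x y} → x ≉ y → ¬ Adj x y → ¬ (lo x ≤ᴿ hi y) ⊎ ¬ (lo y ≤ᴿ hi x)
    separated {x} {y} x≉y ¬xy with lo x ≤ᴿ? hi y | lo y ≤ᴿ? hi x
    ... | no x≰y  | _       = inj₁ x≰y
    ... | yes _   | no y≰x  = inj₂ y≰x
    ... | yes x≤y | yes y≤x = contradiction (≤⇒adj x≉y x≤y y≤x) ¬xy

    -- If `hi x < lo w` and `hi z < lo y`, the edges wz and xy give
    -- `hi x < lo w ≤ hi z < lo y ≤ hi x`. The other orders follow by exchanging names.
    no-4-cycle : ∀ {w x y z} → w ≉ x → ¬ Adj w x → y ≉ z → ¬ Adj y z →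
      Adj w y → Adj w z → Adj x y → Adj x z → ⊥
    no-4-cycle {w} {x} {y} {z} w≉x ¬wx y≉z ¬yz wy wz xy xz
      with separated w≉x ¬wx | separated y≉z ¬yz
    ... | inj₁ w≰x | inj₁ y≰z = crossing (lo w) (lo y) (hi x) (hi z) w≰x y≰z
      (adj⇒≤ wz) (adj⇒≤ (adj-sym xy))
    ... | inj₁ w≰x | inj₂ z≰y = crossing (lo w) (lo z) (hi x) (hi y) w≰x z≰y
      (adj⇒≤ wy) (adj⇒≤ (adj-sym xz))
    ... | inj₂ x≰w | inj₁ y≰z = crossing (lo x) (lo y) (hi w) (hi z) x≰w y≰z
      (adj⇒≤ xz) (adj⇒≤ (adj-sym wy))
    ... | inj₂ x≰w | inj₂ z≰y = crossing (lo x) (lo z) (hi w) (hi y) x≰w z≰y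
      (adj⇒≤ xy) (adj⇒≤ (adj-sym wz))

    Left Right : Carrier → Carrier → Carrier → Set
    Left  x y b = ¬ (lo x ≤ᴿ hi b) × ¬ (lo y ≤ᴿ hi b)
    Right x y b = ¬ (lo b ≤ᴿ hi x) × ¬ (lo b ≤ᴿ hi y)

    -- The union of two overlapping intervals is an interval, so b cannot lie between them.
    sameSide : ∀ {x y b} → Adj x y → x ≉ b → ¬ Adj x b → y ≉ b → ¬ Adj y b →
      Left x y b ⊎ Right x y b
    sameSide {x} {y} {b} xy x≉b ¬xb y≉b ¬yb with separated x≉b ¬xb | separated y≉b ¬yb
    ... | inj₁ x≰b | inj₁ y≰b = inj₁ (x≰b , y≰b)
    ... | inj₂ b≰x | inj₂ b≰y = inj₂ (b≰x , b≰y)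
    ... | inj₁ x≰b | inj₂ b≰y = ⊥-elim (x≰b
      (≤ᴿ-trans (lo x) (hi y) (hi b) (adj⇒≤ xy)
        (≤ᴿ-trans (hi y) (lo b) (hi b) (≰ᴿ⇒≥ᴿ (lo b) (hi y) b≰y) (Interval.lo≤hi (interval b)))))
    ... | inj₂ b≰x | inj₁ y≰b = ⊥-elim (y≰b
      (≤ᴿ-trans (lo y) (hi x) (hi b) (adj⇒≤ (adj-sym xy))
        (≤ᴿ-trans (hi x) (lo b) (hi b) (≰ᴿ⇒≥ᴿ (lo b) (hi x) b≰x) (Interval.lo≤hi (interval b)))))

    -- Of the three intervals b_xy, b_xz, b_yz two lie on the same side of
    -- those intervals among x, y, z that they miss.
    no-triple : ∀ {x y z bxy bxz byz} → Adj x y → Adj x z → Adj y z →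
      x ≉ bxy → ¬ Adj x bxy → y ≉ bxy → ¬ Adj y bxy → Adj z bxy →
      x ≉ bxz → ¬ Adj x bxz → z ≉ bxz → ¬ Adj z bxz → Adj y bxz →
      y ≉ byz → ¬ Adj y byz → z ≉ byz → ¬ Adj z byz → Adj x byz → ⊥
    no-triple {x} {y} {z} {bxy} {bxz} {byz} xy xz yz n₁ m₁ n₂ m₂ a₁ n₃ m₃ n₄ m₄ a₂ n₅ m₅ n₆ m₆ a₃
      with sameSide xy n₁ m₁ n₂ m₂ | sameSide xz n₃ m₃ n₄ m₄ | sameSide yz n₅ m₅ n₆ m₆
    ... | inj₁ (p , q) | inj₁ (r , s) | _ = crossing (lo y) (lo z) (hi bxy) (hi bxz) q s
      (adj⇒≤ a₂) (adj⇒≤ a₁)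
    ... | inj₂ (p , q) | inj₂ (r , s) | _ =
      crossing (lo bxy) (lo bxz) (hi y) (hi z) q s (adj⇒≤ (adj-sym a₁)) (adj⇒≤ (adj-sym a₂))
    ... | inj₁ (p , q) | inj₂ _ | inj₁ (r , s) = crossing (lo x) (lo z) (hi bxy) (hi byz) p s
      (adj⇒≤ a₃) (adj⇒≤ a₁)
    ... | inj₁ _ | inj₂ (p , q) | inj₂ (r , s) =
      crossing (lo bxz) (lo byz) (hi x) (hi y) p r (adj⇒≤ (adj-sym a₂)) (adj⇒≤ (adj-sym a₃))
    ... | inj₂ _ | inj₁ (p , q) | inj₁ (r , s) = crossing (lo x) (lo y) (hi bxz) (hi byz) p r
      (adj⇒≤ a₃) (adj⇒≤ a₂)
    ... | inj₂ (p , q) | inj₁ _ | inj₂ (r , s) =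
      crossing (lo bxy) (lo byz) (hi x) (hi z) p s (adj⇒≤ (adj-sym a₁)) (adj⇒≤ (adj-sym a₃))

  -- Lower bounds on the number of interval graphs.

  module _ {V : Setoid a a} {G : SimpleGraph V a} {d : ℕ}
    (box : IsIntersectionOfIntervalGraphs G d) where
    open Setoid V using (Carrier; _≈_; _≉_) renaming (sym to ≈-sym)
    open SimpleGraph
    open Equivalence

    private
      I = proj₁ box
      isInterval = proj₁ (proj₂ box)
      adj⇔ = λ {x y} → proj₂ (proj₂ box) {x} {y}
      open module J {j} = IntervalGraph (isInterval j) using (no-4-cycle; no-triple)

    adjᵢ : ∀ {x y} → Adj G x y → ∀ j → Adj (I j) x y
    adjᵢ xy = to (adj⇔ λ x≈y → adj-irrefl G x≈y xy) xy

    missed : ∀ {x y} → x ≉ y → ¬ Adj G x y → ∃ λ j → ¬ Adj (I j) x y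
    missed x≉y ¬xy = ¬∀⟶∃¬ d _ (λ j → em (Adj (I j) _ _)) (¬xy ∘ from (adj⇔ x≉y))

    nonAdjacent⇒1≤ : ∀ {x y} → x ≉ y → ¬ Adj G x y → 1 ≤ d
    nonAdjacent⇒1≤ x≉y ¬xy = ℕ.≤-trans (s≤s z≤n) (toℕ<n (proj₁ (missed x≉y ¬xy)))

    -- Two pairs missing from the same interval graph would be the diagonals of an induced
    -- four-cycle there, so choosing a graph for each pair is injective.
    cocktailParty⇒≤ : ∀ {n} (x y : Fin n → Carrier) →
      (∀ i → x i ≉ y i) → (∀ i → ¬ Adj G (x i) (y i)) →
      (∀ {i k} → i ≢ k → Adj G (x i) (x k)) →
      (∀ {i k} → i ≢ k → Adj G (x i) (y k)) →
      (∀ {i k} → i ≢ k → Adj G (y i) (y k)) →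
      n ≤ d
    cocktailParty⇒≤ {n} x y x≉y ¬xy xx xy yy = injective⇒≤ {f = miss} miss-injective
      where
      miss : Fin n → Fin d
      miss i = proj₁ (missed (x≉y i) (¬xy i))
      miss-injective : ∀ {i k} → miss i ≡ miss k → i ≡ k
      miss-injective {i} {k} eq with i ≟ k
      ... | yes i≡k = i≡k
      ... | no  i≢k = ⊥-elim (no-4-cycle (x≉y i) (proj₂ (missed (x≉y i) (¬xy i)))
        (x≉y k) (subst (λ j → ¬ Adj (I j) (x k) (y k)) (sym eq) (proj₂ (missed (x≉y k) (¬xy k))))
        (adjᵢ (xx i≢k) _) (adjᵢ (xy i≢k) _)
        (adjᵢ (adj-sym G (xy (i≢k ∘ sym))) _) (adjᵢ (yy i≢k) _))

    -- Here `s i` stands for {i} and `b i k` for {i,k}. Colour j contains (i,k) if graph j lacks the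
    -- edge from `s i` to `b i k`; two disjoint pairs of one colour would give a four-cycle.
    pairs⇒≤ : ∀ {n} (s : Fin n → Carrier) (b : Fin n → Fin n → Carrier) →
      (∀ {i k} → b i k ≈ b k i) →
      (∀ {i k} → i ≢ k → s i ≉ b i k) → (∀ {i k} → i ≢ k → ¬ Adj G (s i) (b i k)) →
      (∀ {i k} → i ≢ k → Adj G (s i) (s k)) →
      (∀ {l i k} → i ≢ k → l ≢ i → l ≢ k → Adj G (s l) (b i k)) →
      (∀ {i k i′ k′} → i ≢ k → i′ ≢ k′ → i ≢ i′ → i ≢ k′ → k ≢ i′ → k ≢ k′ →
        Adj G (b i k) (b i′ k′)) →
      n ≤ suc d
    pairs⇒≤ {n} s b b-sym s≉b ¬sb ss sb bb =
      pairCover⇒≤ d n C (λ j x y → em (C j x y)) proj₁ meet hex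
        (λ x≢y → let j , m = missed (s≉b x≢y) (¬sb x≢y) in j , x≢y , m)
      where
      C : Fin d → Fin n → Fin n → Set a
      C j i k = i ≢ k × ¬ Adj (I j) (s i) (b i k)
      swapped : ∀ {j i k} → C j i k → ¬ Adj (I j) (s i) (b k i)
      swapped (_ , m) a = m (proj₁ (adj-resp (I _)) b-sym a)
      s≉b′ : ∀ {i k} → i ≢ k → s i ≉ b k i
      s≉b′ i≢k e = s≉b i≢k (Setoid.trans V e b-sym)
      meet : ∀ {j x y x′ y′} → C j x y → C j x′ y′ → (x ∈₂ x′ , y′) ⊎ (y ∈₂ x′ , y′)
      meet {j} {x} {y} {x′} {y′} (x≢y , m) (x′≢y′ , m′)
        with x ≟ x′ | x ≟ y′ | y ≟ x′ | y ≟ y′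
      ... | yes p | _     | _     | _     = inj₁ (inj₁ p)
      ... | no _  | yes p | _     | _     = inj₁ (inj₂ p)
      ... | no _  | no _  | yes p | _     = inj₂ (inj₁ p)
      ... | no _  | no _  | no _  | yes p = inj₂ (inj₂ p)
      ... | no p  | no q  | no r  | no t  = ⊥-elim
        (no-4-cycle (s≉b x≢y) m (s≉b x′≢y′) m′
          (adjᵢ (ss p) j) (adjᵢ (sb x′≢y′ p q) j)
          (adjᵢ (adj-sym G (sb x≢y (p ∘ sym) (r ∘ sym))) j) (adjᵢ (bb x≢y x′≢y′ p q r t) j))
      hex : ∀ j p q r → p ≢ q → r ≢ p → r ≢ q →
        ¬ (∀ k → uncurry (C j) (lookup (hexagon p q r) k))
      -- Entries 1, 3 and 5 concern `b` with its indices reversed; `swapped` turns them into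
      -- statements about the same three vertices `b p q`, `b p r`, `b q r`.
      hex j p q r p≢q r≢p r≢q h = no-triple {j}
        (adjᵢ (ss p≢q) j) (adjᵢ (ss (r≢p ∘ sym)) j) (adjᵢ (ss (r≢q ∘ sym)) j)
        (s≉b p≢q) (proj₂ (h 0F)) (s≉b′ (p≢q ∘ sym)) (swapped (h 1F))
        (adjᵢ (sb p≢q r≢p r≢q) j)
        (s≉b (r≢p ∘ sym)) (proj₂ (h 2F)) (s≉b′ r≢p) (swapped (h 3F))
        (adjᵢ (sb (r≢p ∘ sym) (p≢q ∘ sym) (r≢q ∘ sym)) j)
        (s≉b (r≢q ∘ sym)) (proj₂ (h 4F)) (s≉b′ r≢q) (swapped (h 5F))
        (adjᵢ (sb (r≢q ∘ sym) p≢q (r≢p ∘ sym)) j)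

-- Primes and exact exponents in a principal ideal domain.

module Domain {c ℓ} (R : CommutativeRing c ℓ)
  (pid : RingNotions.IsPrincipalIdealDomain R) where
  open RingNotions R
  open IsPrincipalIdealDomain pid
  open CommutativeRing R
    using (-_; *-cong; *-congˡ; *-congʳ; *-assoc; *-comm; *-identityˡ; *-identityʳ; zeroʳ; +-cong;
      +-congˡ; +-congʳ; +-assoc; +-identityˡ; +-identityʳ; -‿cong; -‿inverseʳ; ring; semiring)
    renaming (setoid to ≈-setoid; refl to ≈-refl; reflexive to ≈-reflexive; sym to ≈-sym;
      trans to ≈-trans)
  open import Algebra.Properties.Ring ring
    using (-‿distribˡ-*; -0#≈0#; -‿involutive; -‿+-comm; [y-z]x≈yx-zx; x∙y⁻¹≈ε⇒x≈y)
  open import Algebra.Properties.Semiring.Exp semiring using (^-homo-*)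
  open import Algebra.Properties.Semiring.Divisibility semiring
    using (∣-trans; ∣-refl; ∣-respʳ; ∣-respˡ; x∣ʳyx; x∣ʳy⇒x∣ʳzy; 1∣_; _∣0)
  open import Algebra.Properties.Monoid.Sum (CommutativeRing.*-monoid R) using (sum-cong-≗)
  open import Algebra.Properties.CommutativeSemigroup (CommutativeRing.*-commutativeSemigroup R)
    using (interchange; xy∙z≈xz∙y)
  open import Relation.Binary.Reasoning.Setoid ≈-setoid
  open Algebra.Definitions.RawMagma (CommutativeRing.*-rawMagma R) using (_∤_)
    renaming (_,_ to _∣,_)

  -- The generator of the ideal of all x with x ≈ 0# ⊎ P decides P.
  excludedMiddle : ExcludedMiddle (c ⊔ ℓ)
  excludedMiddle P = decide
    where
    ideal : Ideal (c ⊔ ℓ)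
    ideal = record
      { Mem      = λ x → x ≈ 0# ⊎ P
      ; Mem-resp = λ x≈y → Sum.map₁ (≈-trans (≈-sym x≈y))
      ; 0∈       = inj₁ ≈-refl
      ; +-closed = λ { (inj₁ x≈0) (inj₁ y≈0) → inj₁ (≈-trans (+-cong x≈0 y≈0) (+-identityˡ 0#))
                     ; (inj₁ _) (inj₂ p) → inj₂ p
                     ; (inj₂ p) _ → inj₂ p }
      ; *-closed = λ r → Sum.map₁ λ x≈0 → ≈-trans (*-congˡ x≈0) (zeroʳ r)
      }
    decide : Dec P
    decide with principal ideal
    ... | g , to , from with from (∣-refl {g})
    ...   | inj₂ p   = yes p
    -- Given P, the ideal contains 1, which would then be a multiple of g ≈ 0.
    ...   | inj₁ g≈0 = no λ p → 1≉0 (1≈0 (∣-respˡ g≈0 (to (inj₂ p))))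
      where
      1≈0 : 0# ∣ 1# → 1# ≈ 0#
      1≈0 (q ∣, q0≈1) = ≈-trans (≈-sym q0≈1) (zeroʳ q)

  cancelʳ : ∀ {x y z} → z ≉ 0# → x * z ≈ y * z → x ≈ y
  cancelʳ {x} {y} {z} z≉0 xz≈yz with noZeroDivisors {x - y} {z} (begin
      (x - y) * z     ≈⟨ [y-z]x≈yx-zx z x y ⟩
      x * z - y * z   ≈⟨ +-congʳ xz≈yz ⟩
      y * z - y * z   ≈⟨ -‿inverseʳ (y * z) ⟩
      0#              ∎)
  ... | inj₁ x-y≈0 = x∙y⁻¹≈ε⇒x≈y x y x-y≈0
  ... | inj₂ z≈0   = contradiction z≈0 z≉0

  ^-monoʳ-∣ : ∀ p {e f} → e ≤ f → p ^ e ∣ p ^ f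
  ^-monoʳ-∣ p {e} {f} e≤f with k , refl ← ℕ.m≤n⇒∃[o]m+o≡n e≤f =
    p ^ k ∣, ≈-trans (*-comm (p ^ k) (p ^ e)) (≈-sym (^-homo-* p e k))

  ∣-*-mono : ∀ {w x y z} → w ∣ x → y ∣ z → w * y ∣ x * z
  ∣-*-mono {w} {y = y} (q ∣, qw≈x) (r ∣, ry≈z) =
    q * r ∣, ≈-trans (interchange q r w y) (*-cong qw≈x ry≈z)

  module _ {p} (prime : Prime p) where
    open Prime prime

    prime^≉0 : ∀ e → p ^ e ≉ 0#
    prime^≉0 zero    = 1≉0
    prime^≉0 (suc e) h with noZeroDivisors h
    ... | inj₁ p≈0  = p≉0 p≈0
    ... | inj₂ p^≈0 = prime^≉0 e p^≈0

    prime∤* : ∀ {x y} → p ∤ x → p ∤ y → p ∤ x * y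
    prime∤* p∤x p∤y p∣xy = [ p∤x , p∤y ]′ (split-∣ p∣xy)

    prime∤^ : ∀ {x} e → p ∤ x → p ∤ x ^ e
    prime∤^ zero    _   = p∤1
    prime∤^ (suc e) p∤x = prime∤* p∤x (prime∤^ e p∤x)

    prime∤product : ∀ {n} (x : Vector Carrier n) → (∀ i → p ∤ x i) → p ∤ product x
    prime∤product {zero}  x _   = p∤1
    prime∤product {suc n} x p∤x = prime∤* (p∤x zero) (prime∤product (x ∘ suc) (p∤x ∘ suc))

    -- As p does not divide y, it divides x; cancelling one p on both sides leaves the case of
    -- exponent e.
    prime^-coprime : ∀ {x y} e → p ∤ y → p ^ e ∣ x * y → p ^ e ∣ x
    prime^-coprime zero    _   _ = 1∣ _
    prime^-coprime {x} {y} (suc e) p∤y (r ∣, eq)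
      with split-∣ {x} {y}
        (r * p ^ e ∣, ≈-trans (≈-trans (xy∙z≈xz∙y r (p ^ e) p) (*-assoc r p (p ^ e))) eq)
    ... | inj₂ p∣y = contradiction p∣y p∤y
    ... | inj₁ (q ∣, qp≈x) = ∣-respʳ (≈-trans (*-comm p q) qp≈x)
      (∣-*-mono ∣-refl (prime^-coprime e p∤y (r ∣, cancelʳ p≉0 (begin
        r * p ^ e * p     ≈⟨ xy∙z≈xz∙y r (p ^ e) p ⟩
        r * p * p ^ e     ≈⟨ *-assoc r p (p ^ e) ⟩
        r * (p * p ^ e)   ≈⟨ eq ⟩
        x * y             ≈⟨ *-congʳ qp≈x ⟨
        q * p * y         ≈⟨ xy∙z≈xz∙y q p y ⟩
        q * y * p         ∎))))

  record Exact (p : Carrier) (e : ℕ) (x : Carrier) : Set (c ⊔ ℓ) where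
    constructor exact
    field
      cofactor : Carrier
      equality : cofactor * p ^ e ≈ x
      coprime  : p ∤ cofactor

  module _ {p} (prime : Prime p) where
    open Prime prime

    exact-∤ : ∀ {x} → p ∤ x → Exact p 0 x
    exact-∤ {x} p∤x = exact x (*-identityʳ x) p∤x

    exact-∣ : ∀ {e x k} → Exact p e x → k ≤ e → p ^ k ∣ x
    exact-∣ (exact q eq _) k≤e = ∣-trans (^-monoʳ-∣ p k≤e) (q ∣, eq)

    exact-∣⇒≤ : ∀ {e x k} → Exact p e x → p ^ k ∣ x → k ≤ e
    exact-∣⇒≤ {e} {x} {k} (exact q eq p∤q) p^k∣x = ℕ.≮⇒≥ λ e<k →
      let r ∣, eq′ = ∣-trans (^-monoʳ-∣ p e<k) p^k∣x in
      p∤q (r ∣, cancelʳ (prime^≉0 prime e) (begin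
        r * p * p ^ e     ≈⟨ *-assoc r p (p ^ e) ⟩
        r * (p * p ^ e)   ≈⟨ eq′ ⟩
        x                 ≈⟨ eq ⟨
        q * p ^ e         ∎))

    exact-* : ∀ {e f x y} → Exact p e x → Exact p f y → Exact p (e ℕ.+ f) (x * y)
    exact-* {e} {f} {x} {y} (exact q eq p∤q) (exact r eq′ p∤r) = exact (q * r) (begin
        q * r * p ^ (e ℕ.+ f)      ≈⟨ *-congˡ (^-homo-* p e f) ⟩
        q * r * (p ^ e * p ^ f)    ≈⟨ interchange q r (p ^ e) (p ^ f) ⟩
        q * p ^ e * (r * p ^ f)    ≈⟨ *-cong eq eq′ ⟩
        x * y                      ∎) (prime∤* prime p∤q p∤r)

    exact-^ : ∀ e → Exact p e (p ^ e)
    exact-^ e = exact 1# (*-identityˡ (p ^ e)) p∤1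

    exact-product : ∀ {n e} (x : Vector Carrier n) k → Exact p e (x k) →
      (∀ i → i ≢ k → p ∤ x i) → Exact p e (product x)
    exact-product {suc n} {e} x zero    ex p∤x = subst (λ e → Exact p e (product x))
      (ℕ.+-identityʳ e)
      (exact-* ex (exact-∤ (prime∤product prime (x ∘ suc) λ i → p∤x (suc i) λ ())))
    exact-product {suc n} {e} x (suc k) ex p∤x = exact-* (exact-∤ (p∤x zero λ ()))
      (exact-product (x ∘ suc) k ex λ i i≢k → p∤x (suc i) (i≢k ∘ suc-injective))

  -- After division by the first prime power the other powers still divide the quotient, because
  -- their primes do not divide the removed factor.
  product-∣ : ∀ {n} (p : Vector Carrier n) (e : Vector ℕ n) {x} →
    (∀ i → Prime (p i)) → (∀ i k → i ≢ k → p i ∤ p k) →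
    (∀ i → p i ^ e i ∣ x) → product (λ i → p i ^ e i) ∣ x
  product-∣ {zero}  p e prime ∤ h = 1∣ _
  product-∣ {suc n} p e {x} prime ∤ h with h zero
  ... | q ∣, eq = ∣-respʳ (≈-trans (*-comm _ q) eq)
    (∣-*-mono ∣-refl (product-∣ (p ∘ suc) (e ∘ suc) (prime ∘ suc)
      (λ i k i≢k → ∤ (suc i) (suc k) (i≢k ∘ suc-injective))
      λ i → prime^-coprime (prime (suc i)) (e (suc i))
        (prime∤^ (prime (suc i)) (e zero) (∤ (suc i) zero λ ()))
        (∣-respʳ (≈-sym eq) (h (suc i)))))

  -- If q = r p, then q divides r or p. The latter makes p and q associated; the former, after
  -- cancelling q, makes p a unit.
  nonAssociated⇒∤ : ∀ {p q} → Prime p → Prime q → p ∦ q → p ∤ q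
  nonAssociated⇒∤ {p} {q} p-prime q-prime p∦q (r ∣, rp≈q)
    with Prime.split-∣ q-prime {r} {p} (1# ∣, ≈-trans (*-identityˡ q) (≈-sym rp≈q))
  ... | inj₂ q∣p = p∦q ((r ∣, rp≈q) , q∣p)
  ... | inj₁ (s ∣, sq≈r) = Prime.p∤1 p-prime (s ∣, cancelʳ (Prime.p≉0 q-prime) (begin
    s * p * q   ≈⟨ xy∙z≈xz∙y s p q ⟩
    s * q * p   ≈⟨ *-congʳ sq≈r ⟩
    r * p       ≈⟨ rp≈q ⟩
    q           ≈⟨ *-identityˡ q ⟨
    1# * q      ∎))

  -- Capped exponents.

  data Valuation (p : Carrier) (m : ℕ) (x : Carrier) : ℕ → Set (c ⊔ ℓ) where
    full    : p ^ m ∣ x → Valuation p m x m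
    partial : ∀ {e} → e < m → Exact p e x → Valuation p m x e

  -- Raising the cap by one keeps every smaller exponent; an exponent that was full before is now
  -- either full again or exactly the old cap.
  valuation : ∀ p m x → ∃ (Valuation p m x)
  valuation p zero    x = zero , full (1∣ x)
  valuation p (suc m) x with excludedMiddle (p ^ suc m ∣ x) | valuation p m x
  ... | yes h | _                  = suc m , full h
  ... | no ¬h | e , partial e<m ex = e , partial (ℕ.m<n⇒m<1+n e<m) ex
  ... | no ¬h | _ , full (q ∣, eq) = m , partial ℕ.≤-refl (exact q eq λ (r ∣, rp≈q) →
    ¬h (r ∣, (begin
      r * (p * p ^ m)   ≈⟨ *-assoc r p (p ^ m) ⟨
      r * p * p ^ m     ≈⟨ *-congʳ rp≈q ⟩
      q * p ^ m         ≈⟨ eq ⟩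
      x                 ∎)))

  valuation-≤ : ∀ {p m x e} → Valuation p m x e → e ≤ m
  valuation-≤ (full _)        = ℕ.≤-refl
  valuation-≤ (partial e<m _) = ℕ.<⇒≤ e<m

  module _ {p} (prime : Prime p) {m : ℕ} where

    valuation-∣ : ∀ {x e k} → Valuation p m x e → k ≤ e → p ^ k ∣ x
    valuation-∣ (full h)       k≤e = ∣-trans (^-monoʳ-∣ p k≤e) h
    valuation-∣ (partial _ ex) k≤e = exact-∣ prime ex k≤e

    ∣-valuation : ∀ {x e k} → Valuation p m x e → k ≤ m → p ^ k ∣ x → k ≤ e
    ∣-valuation (full _)       k≤m _ = k≤m
    ∣-valuation (partial _ ex) _   h = exact-∣⇒≤ prime ex h

    -- If one exponent is full, the bound on the sum is immediate; otherwise both are exact and add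
    -- up.
    valuation-*⇔ : ∀ {x y e f} → Valuation p m x e → Valuation p m y f →
      p ^ m ∣ x * y ⇔ m ≤ e ℕ.+ f
    valuation-*⇔ {x} {y} {e} {f} vx vy = mk⇔ (to vx vy) λ m≤e+f →
      ∣-trans (^-monoʳ-∣ p m≤e+f) (∣-respˡ (≈-sym (^-homo-* p e f))
        (∣-*-mono (valuation-∣ vx ℕ.≤-refl) (valuation-∣ vy ℕ.≤-refl)))
      where
      to : ∀ {e f} → Valuation p m x e → Valuation p m y f → p ^ m ∣ x * y → m ≤ e ℕ.+ f
      to (full _)       _              _ = ℕ.m≤m+n _ _
      to (partial _ _)  (full _)       _ = ℕ.m≤n+m _ _
      to (partial _ ex) (partial _ ey) h = exact-∣⇒≤ prime (exact-* prime ex ey) h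

  -- Congruences and residues modulo a prime.

  x-0≈x : ∀ x → x - 0# ≈ x
  x-0≈x x = ≈-trans (+-congˡ -0#≈0#) (+-identityʳ x)

  module Modulo (d : Carrier) where
    private module R/d = CommutativeRing (quotientRing ⟨ d ⟩)

    ≈⇒~ : ∀ {x y} → x ≈ y → d ∣ x - y
    ≈⇒~ x≈y = ∣-respʳ (≈-sym (≈-trans (+-congʳ x≈y) (-‿inverseʳ _))) (d ∣0)

    ∣⇒~0 : ∀ {x} → d ∣ x → d ∣ x - 0#
    ∣⇒~0 = ∣-respʳ (≈-sym (x-0≈x _))

    ~0⇒∣ : ∀ {x} → d ∣ x - 0# → d ∣ x
    ~0⇒∣ = ∣-respʳ (x-0≈x _)

    ∣-minus : ∀ {x y} → d ∣ x → d ∣ y → d ∣ x - y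
    ∣-minus d∣x d∣y = R/d.trans (∣⇒~0 d∣x) (R/d.sym (∣⇒~0 d∣y))

    ∣-resp-~ : ∀ {x y} → d ∣ x - y → d ∣ x → d ∣ y
    ∣-resp-~ x~y d∣x = ~0⇒∣ (R/d.trans (R/d.sym x~y) (∣⇒~0 d∣x))

  x+y-y≈x : ∀ x y → (x + y) - y ≈ x
  x+y-y≈x x y = ≈-trans (+-assoc x y (- y)) (≈-trans (+-congˡ (-‿inverseʳ y)) (+-identityʳ x))

  module _ {p} (prime : Prime p) where
    open Prime prime
    open Modulo p

    prime∤1+p : p ∤ 1# + p
    prime∤1+p h = p∤1 (∣-respʳ (x+y-y≈x 1# p) (∣-minus h ∣-refl))

    prime∤1-p : p ∤ 1# - p
    prime∤1-p h = p∤1 (∣-resp-~ (CommutativeRing.sym (quotientRing ⟨ p ⟩) h) ∣-refl)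

    -- The difference is -p, and p does not divide -1 because (-1)(-1) = 1.
    exact-1-[1+p] : Exact p 1 (1# - (1# + p))
    exact-1-[1+p] = exact (- 1#)
      (begin
        - 1# * (p * 1#)       ≈⟨ *-congˡ (*-identityʳ p) ⟩
        - 1# * p              ≈⟨ -‿distribˡ-* 1# p ⟨
        - (1# * p)            ≈⟨ -‿cong (*-identityˡ p) ⟩
        - p                   ≈⟨ +-identityˡ (- p) ⟨
        0# - p                ≈⟨ +-congʳ (-‿inverseʳ 1#) ⟨
        1# - 1# - p           ≈⟨ +-assoc 1# (- 1#) (- p) ⟩
        1# + (- 1# - p)       ≈⟨ +-congˡ (-‿+-comm 1# p) ⟩
        1# - (1# + p)         ∎)
      (λ h → p∤1 (∣-respʳ (begin
        - 1# * - 1#      ≈⟨ -‿distribˡ-* 1# (- 1#) ⟨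
        - (1# * - 1#)    ≈⟨ -‿cong (*-identityˡ (- 1#)) ⟩
        - - 1#           ≈⟨ -‿involutive 1# ⟩
        1#               ∎) (x∣ʳy⇒x∣ʳzy (- 1#) h)))

    -- One of the two classes is that of 0, so x and y share the other.
    twoResidues : HasCardinality (quotientSetoid ⟨ p ⟩) 2 → ∀ {x y} → p ∤ x → p ∤ y → p ∣ x - y
    twoResidues card {x} {y} p∤x p∤y =
      R/p.trans (R/p.sym (to-index x)) (R/p.trans
        (R/p.reflexive (cong (Bijection.to card)
          (sameOf (λ e → p∤x (separated e)) (λ e → p∤y (separated e)))))
        (to-index y))
      where
      module R/p = Setoid (quotientSetoid ⟨ p ⟩)
      index : Carrier → Fin 2
      index x = proj₁ (Bijection.strictlySurjective card x)
      to-index : ∀ x → Bijection.to card (index x) R/p.≈ x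
      to-index x = proj₂ (Bijection.strictlySurjective card x)
      separated : ∀ {x} → index x ≡ index 0# → p ∣ x
      separated {x} e = ~0⇒∣ (R/p.trans (R/p.sym (to-index x))
        (R/p.trans (R/p.reflexive (cong (Bijection.to card) e)) (to-index 0#)))
      sameOf : ∀ {i j k : Fin 2} → i ≢ k → j ≢ k → i ≡ j
      sameOf {0F} {0F} {_}  _ _ = refl
      sameOf {1F} {1F} {_}  _ _ = refl
      sameOf {0F} {1F} {0F} h _ = contradiction refl h
      sameOf {0F} {1F} {1F} _ h = contradiction refl h
      sameOf {1F} {0F} {0F} _ h = contradiction refl h
      sameOf {1F} {0F} {1F} h _ = contradiction refl h

    -- The classes of 0 and 1 contain at most one each of three incongruent elements.
    threeResidues : HasAtLeast (quotientSetoid ⟨ p ⟩) 3 → ∃ λ t → p ∤ t × p ∤ 1# - t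
    threeResidues inj
      with bad? (Injection.to inj 0F) | bad? (Injection.to inj 1F) | bad? (Injection.to inj 2F)
      where
      bad? : ∀ t → Dec (p ∣ t ⊎ p ∣ 1# - t)
      bad? t = excludedMiddle (p ∣ t ⊎ p ∣ 1# - t)
    ... | no h  | _     | _     = _ , (λ d → h (inj₁ d)) , (λ d → h (inj₂ d))
    ... | yes _ | no h  | _     = _ , (λ d → h (inj₁ d)) , (λ d → h (inj₂ d))
    ... | yes _ | yes _ | no h  = _ , (λ d → h (inj₁ d)) , (λ d → h (inj₂ d))
    ... | yes a | yes b | yes d = ⊥-elim (clash a b d)
      where
      module R/p = Setoid (quotientSetoid ⟨ p ⟩)
      f = Injection.to inj
      Bad : Carrier → Set (c ⊔ ℓ)
      Bad t = p ∣ t ⊎ p ∣ 1# - t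
      zeros : ∀ i j → i ≢ j → p ∣ f i → p ∣ f j → ⊥
      zeros i j i≢j a b = i≢j (Injection.injective inj (∣-minus a b))
      ones : ∀ i j → i ≢ j → p ∣ 1# - f i → p ∣ 1# - f j → ⊥
      ones i j i≢j a b = i≢j (Injection.injective inj (R/p.trans (R/p.sym a) b))
      clash : Bad (f 0F) → Bad (f 1F) → Bad (f 2F) → ⊥
      clash (inj₁ a) (inj₁ b) _        = zeros 0F 1F (λ ()) a b
      clash (inj₁ a) _        (inj₁ b) = zeros 0F 2F (λ ()) a b
      clash _        (inj₁ a) (inj₁ b) = zeros 1F 2F (λ ()) a b
      clash (inj₂ a) (inj₂ b) _        = ones 0F 1F (λ ()) a b
      clash (inj₂ a) _        (inj₂ b) = ones 0F 2F (λ ()) a b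
      clash _        (inj₂ a) (inj₂ b) = ones 1F 2F (λ ()) a b

    hasTwoResidues : (∀ t → p ∣ t ⊎ p ∣ 1# - t) → HasCardinality (quotientSetoid ⟨ p ⟩) 2
    hasTwoResidues split = record
      { to        = to
      ; cong      = λ { refl → R/p.refl }
      ; bijective = injective , surjective
      }
      where
      module R/p = Setoid (quotientSetoid ⟨ p ⟩)
      to : Fin 2 → Carrier
      to 0F = 0#
      to 1F = 1#
      injective : ∀ {i j} → to i R/p.≈ to j → i ≡ j
      injective {0F} {0F} _ = refl
      injective {0F} {1F} h = contradiction (~0⇒∣ (R/p.sym h)) p∤1
      injective {1F} {0F} h = contradiction (~0⇒∣ h) p∤1
      injective {1F} {1F} _ = refl
      surjective : ∀ x → ∃ λ i → ∀ {j} → j ≡ i → to j R/p.≈ x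
      surjective x with split x
      ... | inj₁ p∣x   = 0F , λ { refl → R/p.sym (∣⇒~0 p∣x) }
      ... | inj₂ p∣1-x = 1F , λ { refl → p∣1-x }

  -- Exponents in the quotient ring.

  module Factored {g u : Carrier} {n : ℕ} (p : Vector Carrier n) (m : Vector ℕ n)
    (unit : IsUnit u) (prime : ∀ i → Prime (p i)) (p∦p : ∀ i k → i ≢ k → p i ∦ p k)
    (1≤m : ∀ i → m i ≥ 1) (g≈ : g ≈ u * product (λ i → p i ^ m i)) where

    Q : CommutativeRing c (c ⊔ ℓ)
    Q = quotientRing ⟨ g ⟩

    module Q = CommutativeRing Q
    open Q using () renaming (_≈_ to _~_; _≉_ to _≁_)
    open Modulo g
    open Equivalence

    V : Setoid (c ⊔ ℓ) (c ⊔ ℓ)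
    V = nonZeroZeroDivisors Q

    Γ : SimpleGraph V (c ⊔ ℓ)
    Γ = zeroDivisorGraph Q

    p∤p : ∀ i k → i ≢ k → p i ∤ p k
    p∤p i k i≢k = nonAssociated⇒∤ (prime i) (prime k) (p∦p i k i≢k)

    combination : Vector ℕ n → Carrier
    combination e = product λ i → p i ^ e i

    combination-exact : ∀ e i → Exact (p i) (e i) (combination e)
    combination-exact e i = exact-product (prime i) (λ i → p i ^ e i) i (exact-^ (prime i) (e i))
      λ k k≢i → prime∤^ (prime i) (e k) (p∤p i k (k≢i ∘ sym))

    -- As u is a unit, g and `combination m` divide each other, and the prime powers in the latter
    -- are coprime.
    ∣-local : ∀ {x} → g ∣ x ⇔ (∀ i → p i ^ m i ∣ x)
    ∣-local {x} = mk⇔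
      (λ g∣x i → ∣-trans (exact-∣ (prime i) (combination-exact m i) ℕ.≤-refl)
        (∣-trans (∣-respʳ (≈-sym g≈) (x∣ʳyx (combination m) u)) g∣x))
      (λ h → ∣-trans g∣combination (product-∣ p m prime p∤p h))
      where
      g∣combination : g ∣ combination m
      g∣combination = let w ∣, wu≈1 = unit in w ∣, (begin
        w * g                     ≈⟨ *-congˡ g≈ ⟩
        w * (u * combination m)   ≈⟨ *-assoc w u (combination m) ⟨
        w * u * combination m     ≈⟨ *-congʳ wu≈1 ⟩
        1# * combination m        ≈⟨ *-identityˡ (combination m) ⟩
        combination m             ∎)

    v : Fin n → Carrier → ℕ
    v i x = proj₁ (valuation (p i) (m i) x)

    v-valuation : ∀ i x → Valuation (p i) (m i) x (v i x)
    v-valuation i x = proj₂ (valuation (p i) (m i) x)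

    v≤m : ∀ i x → v i x ≤ m i
    v≤m i x = valuation-≤ (v-valuation i x)

    ∣⇔≤v : ∀ {i x k} → k ≤ m i → p i ^ k ∣ x ⇔ k ≤ v i x
    ∣⇔≤v {i} {x} k≤m =
      mk⇔ (∣-valuation (prime i) (v-valuation i x) k≤m) (valuation-∣ (prime i) (v-valuation i x))

    ~0⇔ : ∀ {x} → x ~ 0# ⇔ (∀ i → m i ≤ v i x)
    ~0⇔ = mk⇔ (λ h i → to (∣⇔≤v ℕ.≤-refl) (to ∣-local (~0⇒∣ h) i))
      (λ h → ∣⇒~0 (from ∣-local λ i → from (∣⇔≤v ℕ.≤-refl) (h i)))

    *~0⇔ : ∀ {x y} → x * y ~ 0# ⇔ (∀ i → m i ≤ v i x ℕ.+ v i y)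
    *~0⇔ {x} {y} = mk⇔
      (λ h i → to (valuation-*⇔ (prime i) (v-valuation i x) (v-valuation i y))
        (to ∣-local (~0⇒∣ h) i))
      (λ h → ∣⇒~0 (from ∣-local λ i →
        from (valuation-*⇔ (prime i) (v-valuation i x) (v-valuation i y)) (h i)))

    -- The cap makes p i ^ v i x a divisor of p i ^ m i, hence of x - y.
    v-cong : ∀ i {x y} → x ~ y → v i x ≡ v i y
    v-cong i x~y = ℕ.≤-antisym (below x~y) (below (Q.sym x~y))
      where
      below : ∀ {x y} → x ~ y → v i x ≤ v i y
      below {x} x~y = to (∣⇔≤v (v≤m i x)) (Modulo.∣-resp-~ (p i ^ v i x)
        (∣-trans (^-monoʳ-∣ (p i) (v≤m i x)) (to ∣-local x~y i))
        (from (∣⇔≤v (v≤m i x)) ℕ.≤-refl))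

    exact⇒≁0 : ∀ {i e x} → Exact (p i) e x → e < m i → x ≁ 0#
    exact⇒≁0 {i} ex e<m x~0 =
      ℕ.<⇒≱ e<m (exact-∣⇒≤ (prime i) ex (to ∣-local (~0⇒∣ x~0) i))

    *~0 : ∀ {x y} (e f : Vector ℕ n) → (∀ i → p i ^ e i ∣ x) → (∀ i → p i ^ f i ∣ y) →
      (∀ i → m i ≤ e i ℕ.+ f i) → x * y ~ 0#
    *~0 e f e∣x f∣y m≤ = ∣⇒~0 (from ∣-local λ i → ∣-trans (^-monoʳ-∣ (p i) (m≤ i))
      (∣-respˡ (≈-sym (^-homo-* (p i) (e i) (f i))) (∣-*-mono (e∣x i) (f∣y i))))

    combination-∣ : ∀ e i → p i ^ e i ∣ combination e
    combination-∣ e i = exact-∣ (prime i) (combination-exact e i) ℕ.≤-refl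

    combination-*~0 : ∀ e f → (∀ i → m i ≤ e i ℕ.+ f i) → combination e * combination f ~ 0#
    combination-*~0 e f = *~0 e f (combination-∣ e) (combination-∣ f)

    -- The difference factors as (1 - t) times `combination e`, with exponent e i + f at p i.
    twist-≁ : ∀ e {t} i {f} → Exact (p i) f (1# - t) → e i ℕ.+ f < m i →
      combination e ≁ t * combination e
    twist-≁ e {t} i {f} ex e+f<m h = exact⇒≁0
      (exact-* (prime i) ex (combination-exact e i))
      (subst (_< m i) (ℕ.+-comm (e i) f) e+f<m)
      (∣⇒~0 (∣-respʳ (begin
        combination e - t * combination e        ≈⟨ +-congʳ (*-identityˡ (combination e)) ⟨
        1# * combination e - t * combination e   ≈⟨ [y-z]x≈yx-zx (combination e) 1# t ⟨
        (1# - t) * combination e                 ∎) h))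

    twist-*≁0 : ∀ e {t} i → p i ∤ t → e i ℕ.+ e i < m i → combination e * (t * combination e) ≁ 0#
    twist-*≁0 e {t} i p∤t = exact⇒≁0 (exact-* (prime i) (combination-exact e i)
      (exact-* (prime i) (exact-∤ (prime i) p∤t) (combination-exact e i)))

    *≁0⇒≁0ˡ : ∀ {x y} → x * y ≁ 0# → x ≁ 0#
    *≁0⇒≁0ˡ xy≁0 x~0 = xy≁0 (Q.trans (Q.*-congʳ x~0) (Q.zeroˡ _))

    *≁0⇒≁0ʳ : ∀ {x y} → x * y ≁ 0# → y ≁ 0#
    *≁0⇒≁0ʳ xy≁0 y~0 = xy≁0 (Q.trans (Q.*-congˡ y~0) (Q.zeroʳ _))

    -- Lower bounds for the zero divisor graph.

    Box : ℕ → Set _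
    Box = IsIntersectionOfIntervalGraphs Γ

    open LowerBounds excludedMiddle

    -- The pairs for `cocktailParty⇒≤` are `combination (e i)` and its multiple by `t i`. The index
    -- l at which the two differ may be other than i, where their product is nonzero.
    twists⇒≤ : ∀ {d} → Box d → (∀ i → ∃ λ k → i ≢ k) →
      (e : Fin n → Vector ℕ n) (t : Fin n → Carrier) →
      (∀ i → p i ∤ t i) → (∀ i → e i i ℕ.+ e i i < m i) →
      (∀ i → ∃ λ l → ∃ λ f → Exact (p l) f (1# - t i) × e i l ℕ.+ f < m l) →
      (∀ {i k} → i ≢ k → ∀ l → m l ≤ e i l ℕ.+ e k l) →
      n ≤ d
    twists⇒≤ box other e t p∤t 2e<m 1-t m≤ = cocktailParty⇒≤ {G = Γ} box X Y
      x≁y (λ i (_ , h) → xy≁0 i h)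
      -- Equality of vertices from different pairs would make the product within one pair zero.
      (λ {i} {k} i≢k → (λ x~x → xy≁0 k (Q.trans (Q.*-congʳ (Q.sym x~x)) (xy~0 i≢k))) , xx~0 i≢k)
      (λ {i} {k} i≢k → (λ x~y → xy≁0 i (Q.trans (Q.*-congʳ x~y)
        (Q.trans (Q.*-comm _ _) (yy~0 i≢k)))) , xy~0 i≢k)
      (λ {i} {k} i≢k → (λ y~y → xy≁0 i (Q.trans (Q.*-congˡ y~y) (xy~0 i≢k))) , yy~0 i≢k)
      where
      x y : Fin n → Carrier
      x i = combination (e i)
      y i = t i * combination (e i)
      y-∣ : ∀ i l → p l ^ e i l ∣ y i
      y-∣ i l = x∣ʳy⇒x∣ʳzy (t i) (combination-∣ (e i) l)
      x≁y : ∀ i → x i ≁ y i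
      x≁y i = let l , f , ex , lt = 1-t i in twist-≁ (e i) l ex lt
      xy≁0 : ∀ i → x i * y i ≁ 0#
      xy≁0 i = twist-*≁0 (e i) i (p∤t i) (2e<m i)
      xx~0 : ∀ {i k} → i ≢ k → x i * x k ~ 0#
      xx~0 i≢k = combination-*~0 (e _) (e _) (m≤ i≢k)
      xy~0 : ∀ {i k} → i ≢ k → x i * y k ~ 0#
      xy~0 {i} {k} i≢k = *~0 (e i) (e k) (combination-∣ (e i)) (y-∣ k) (m≤ i≢k)
      yy~0 : ∀ {i k} → i ≢ k → y i * y k ~ 0#
      yy~0 {i} {k} i≢k = *~0 (e i) (e k) (y-∣ i) (y-∣ k) (m≤ i≢k)
      X Y : Fin n → Setoid.Carrier V
      X i = let k , i≢k = other i in
        x i , (y k , *≁0⇒≁0ʳ (xy≁0 k) , xy~0 i≢k) , *≁0⇒≁0ˡ (xy≁0 i)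
      Y i = let k , i≢k = other i in
        y i , (y k , *≁0⇒≁0ʳ (xy≁0 k) , yy~0 i≢k) , *≁0⇒≁0ʳ (xy≁0 i)

    off : Fin n → Fin n → Vector ℕ n
    off i k l with l ≟ i | l ≟ k
    ... | no _ | no _ = m l
    ... | _    | _    = 0

    off-∈ : ∀ {i k l} → l ∈₂ i , k → off i k l ≡ 0
    off-∈ {i} {k} {l} l∈ with l ≟ i | l ≟ k
    ... | yes _ | yes _ = refl
    ... | yes _ | no _  = refl
    ... | no _  | yes _ = refl
    ... | no p  | no q  = contradiction l∈ [ p , q ]′

    off-∉ : ∀ {i k l} → ¬ (l ∈₂ i , k) → off i k l ≡ m l
    off-∉ {i} {k} {l} l∉ with l ≟ i | l ≟ k
    ... | yes p | _     = contradiction (inj₁ p) l∉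
    ... | no _  | yes q = contradiction (inj₂ q) l∉
    ... | no _  | no _  = refl

    off-disjoint : ∀ {i k i′ k′} → (∀ l → l ∈₂ i , k → ¬ (l ∈₂ i′ , k′)) →
      ∀ l → m l ≤ off i k l ℕ.+ off i′ k′ l
    off-disjoint {i} {k} {i′} {k′} disjoint l with l ≟ i | l ≟ k
    ... | no _  | no _  = ℕ.m≤m+n _ _
    ... | yes p | yes _ = ℕ.≤-reflexive (sym (off-∉ (disjoint l (inj₁ p))))
    ... | yes p | no _  = ℕ.≤-reflexive (sym (off-∉ (disjoint l (inj₁ p))))
    ... | no _  | yes q = ℕ.≤-reflexive (sym (off-∉ (disjoint l (inj₂ q))))

    -- These elements play the part of the sets {i,k}: D i k and D i′ k′ multiply
    -- to zero in Q precisely when the two sets are disjoint.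
    D : Fin n → Fin n → Carrier
    D i k = combination (off i k)

    D-exact : ∀ {i k l} → l ∈₂ i , k → Exact (p l) 0 (D i k)
    D-exact {i} {k} {l} l∈ =
      subst (λ e → Exact (p l) e (D i k)) (off-∈ l∈) (combination-exact (off i k) l)

    D-∣ : ∀ {i k l} → ¬ (l ∈₂ i , k) → p l ^ m l ∣ D i k
    D-∣ {i} {k} {l} l∉ = subst (λ e → p l ^ e ∣ D i k) (off-∉ l∉) (combination-∣ (off i k) l)

    D≁0 : ∀ i k → D i k ≁ 0#
    D≁0 i k = exact⇒≁0 (D-exact (inj₁ refl)) (1≤m i)

    D*D≁0 : ∀ {i k i′ k′} l → l ∈₂ i , k → l ∈₂ i′ , k′ → D i k * D i′ k′ ≁ 0#
    D*D≁0 l l∈ l∈′ = exact⇒≁0 (exact-* (prime l) (D-exact l∈) (D-exact l∈′)) (1≤m l)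

    D*D~0 : ∀ {i k i′ k′} → (∀ l → l ∈₂ i , k → ¬ (l ∈₂ i′ , k′)) → D i k * D i′ k′ ~ 0#
    D*D~0 disjoint = combination-*~0 (off _ _) (off _ _) (off-disjoint disjoint)

    D≁D : ∀ {i k i′ k′} l → l ∈₂ i , k → ¬ (l ∈₂ i′ , k′) → D i k ≁ D i′ k′
    D≁D {i} {k} {i′} {k′} l l∈ l∉ h = ℕ.<⇒≱ (1≤m l) (exact-∣⇒≤ (prime l) (D-exact l∈)
      (Modulo.∣-resp-~ (p l ^ m l) (to ∣-local (Q.sym {D i k} {D i′ k′} h) l) (D-∣ l∉)))

    off-sym : ∀ i k l → off i k l ≡ off k i l
    off-sym i k l with l ≟ i | l ≟ k
    ... | yes _ | yes _ = refl
    ... | yes _ | no _  = refl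
    ... | no _  | yes _ = refl
    ... | no _  | no _  = refl

    D-sym : ∀ i k → D i k ~ D k i
    D-sym i k = ≈⇒~ (≈-reflexive (sum-cong-≗ λ l → cong (p l ^_) (off-sym i k l)))

    DD~0 : ∀ {i k} → i ≢ k → D i i * D k k ~ 0#
    DD~0 i≢k = D*D~0 λ { l (inj₁ refl) → [ i≢k , i≢k ]′ ; l (inj₂ refl) → [ i≢k , i≢k ]′ }

    -- A third index l provides `D l l`, which witnesses that `D i k` is a zero divisor.
    D-pairs⇒≤ : ∀ {d} → Box d → (∀ i k → ∃ λ l → l ≢ i × l ≢ k) → n ≤ suc d
    D-pairs⇒≤ box third = pairs⇒≤ {G = Γ} box (λ i → B i i) B (λ {i} {k} → D-sym i k)
      (λ {i} {k} i≢k h → D≁D k (inj₂ refl) [ i≢k ∘ sym , i≢k ∘ sym ]′ (Q.sym {D i i} {D i k} h))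
      (λ {i} i≢k (_ , h) → D*D≁0 i (inj₁ refl) (inj₁ refl) h)
      (λ {i} {k} i≢k → adjacent i (inj₁ refl) λ
        { l (inj₁ refl) → [ i≢k , i≢k ]′ ; l (inj₂ refl) → [ i≢k , i≢k ]′ })
      (λ {l} i≢k l≢i l≢k → adjacent l (inj₁ refl) λ
        { l (inj₁ refl) → [ l≢i , l≢k ]′ ; l (inj₂ refl) → [ l≢i , l≢k ]′ })
      (λ {i} i≢k i′≢k′ i≢i′ i≢k′ k≢i′ k≢k′ → adjacent i (inj₁ refl) λ
        { l (inj₁ refl) → [ i≢i′ , i≢k′ ]′ ; l (inj₂ refl) → [ k≢i′ , k≢k′ ]′ })
      where
      B : Fin n → Fin n → Setoid.Carrier V
      B i k = let l , l≢i , l≢k = third i k in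
        D i k , (D l l , D≁0 l l , D*D~0 λ
          { _ (inj₁ refl) → [ l≢i ∘ sym , l≢i ∘ sym ]′
          ; _ (inj₂ refl) → [ l≢k ∘ sym , l≢k ∘ sym ]′ }) , D≁0 i k
      adjacent : ∀ {i k i′ k′} l → l ∈₂ i , k → (∀ l → l ∈₂ i , k → ¬ (l ∈₂ i′ , k′)) →
        SimpleGraph.Adj Γ (B i k) (B i′ k′)
      adjacent l l∈ disjoint = D≁D l l∈ (disjoint l l∈) , D*D~0 disjoint

    -- Multiplication by t fixes no element that is not divisible by p i, but
    -- keeps its exponent at p i.
    Twist : Fin n → Set (c ⊔ ℓ)
    Twist i = ∃ λ t → p i ∤ t × ∃ λ f → Exact (p i) f (1# - t) × f < m i

    -- For t = 1 + p i the difference 1 - t has exponent 1, which is below the cap 2.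
    square⇒twist : ∀ i → m i ≡ 2 → Twist i
    square⇒twist i m≡2 = 1# + p i , prime∤1+p (prime i) , 1 , exact-1-[1+p] (prime i) ,
      ℕ.≤-reflexive (sym m≡2)

    threeResidues⇒twist : ∀ i → HasAtLeast (quotientSetoid ⟨ p i ⟩) 3 → Twist i
    threeResidues⇒twist i three =
      let t , p∤t , p∤1-t = threeResidues (prime i) three in
      t , p∤t , 0 , exact-∤ (prime i) p∤1-t , 1≤m i

    -- An element outside the classes of 0 and 1 would be a multiplier with f = 0.
    ¬twist⇒twoResidues : ∀ i → ¬ Twist i → HasCardinality (quotientSetoid ⟨ p i ⟩) 2
    ¬twist⇒twoResidues i ¬twist = hasTwoResidues (prime i) split
      where
      split : ∀ t → p i ∣ t ⊎ p i ∣ 1# - t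
      split t with excludedMiddle (p i ∣ t) | excludedMiddle (p i ∣ 1# - t)
      ... | yes p∣t | _         = inj₁ p∣t
      ... | no _    | yes p∣1-t = inj₂ p∣1-t
      ... | no p∤t  | no p∤1-t  =
        contradiction (t , p∤t , 0 , exact-∤ (prime i) p∤1-t , 1≤m i) ¬twist

    allTwists⇒≤ : ∀ {d} → Box d → (∀ i → ∃ λ k → i ≢ k) → (∀ i → Twist i) → n ≤ d
    allTwists⇒≤ box other twist = twists⇒≤ box other (λ i → off i i) (proj₁ ∘ twist)
      (proj₁ ∘ proj₂ ∘ twist)
      (λ i → subst (λ e → e ℕ.+ e < m i) (sym (off-∈ {i} {i} (inj₁ refl))) (1≤m i))
      (λ i → let _ , _ , f , ex , f<m = twist i in
        i , f , ex , subst (λ e → e ℕ.+ f < m i) (sym (off-∈ {i} {i} (inj₁ refl))) f<m)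
      (λ i≢k → off-disjoint λ
        { l (inj₁ refl) → [ i≢k , i≢k ]′ ; l (inj₂ refl) → [ i≢k , i≢k ]′ })

    -- The vertices `D i i` and `t * D i i` are distinct and non-adjacent; `D k k` annihilates both.
    twist⇒1≤ : ∀ {d i k} → Box d → i ≢ k → Twist i → 1 ≤ d
    twist⇒1≤ {i = i} {k} box i≢k (t , p∤t , f , ex , f<m) = nonAdjacent⇒1≤ {G = Γ} box
      {D i i , (D k k , D≁0 k k , DD~0 i≢k) , D≁0 i i}
      {t * D i i , (D k k , D≁0 k k , tDD~0) , *≁0⇒≁0ʳ DtD≁0}
      (twist-≁ (off i i) i ex (subst (λ e → e ℕ.+ f < m i) (sym (off-∈ {i} {i} (inj₁ refl))) f<m))
      (λ (_ , DtD~0) → DtD≁0 DtD~0)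
      where
      DtD≁0 : D i i * (t * D i i) ≁ 0#
      DtD≁0 = twist-*≁0 (off i i) i p∤t
        (subst (λ e → e ℕ.+ e < m i) (sym (off-∈ {i} {i} (inj₁ refl))) (1≤m i))
      tDD~0 : t * D i i * D k k ~ 0#
      tDD~0 = Q.trans (Q.*-assoc t (D i i) (D k k))
        (Q.trans (Q.*-congˡ {t} (DD~0 i≢k)) (Q.zeroʳ t))

    -- At k the exponents 1 and m k ∸ 1 multiply to zero with each other and
    -- with themselves, except for 1 with itself; this frees a pair of
    -- non-adjacent vertices for k, and p k serves as the multiplier for i ≢ k.
    module Cube (k : Fin n) (3≤m : m k ≥ 3) where

      e : Fin n → Vector ℕ n
      e i l with l ≟ i | l ≟ k
      ... | yes _ | yes _ = 1
      ... | yes _ | no _  = 0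
      ... | no _  | yes _ = m l ∸ 1
      ... | no _  | no _  = m l

      t : Fin n → Carrier
      t i with i ≟ k
      ... | yes _ = 1# + p k
      ... | no _  = p k

      p∤t : ∀ i → p i ∤ t i
      p∤t i with i ≟ k
      ... | yes refl = prime∤1+p (prime i)
      ... | no i≢k   = p∤p i k i≢k

      2e<m : ∀ i → e i i ℕ.+ e i i < m i
      2e<m i with i ≟ i | i ≟ k
      ... | yes _ | yes refl = 3≤m
      ... | yes _ | no _     = 1≤m i
      ... | no i≢i | _       = contradiction refl i≢i

      1-t : ∀ i → ∃ λ l → ∃ λ f → Exact (p l) f (1# - t i) × e i l ℕ.+ f < m l
      1-t i with i ≟ k
      -- Both `e k k` and the exponent of 1 - t at k are 1, so the bound is 2 < m k.
      ... | yes refl = k , 1 , exact-1-[1+p] (prime k) , bound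
        where
        bound : e k k ℕ.+ 1 < m k
        bound with k ≟ k
        ... | yes _  = 3≤m
        ... | no k≢k = contradiction refl k≢k
      -- With multiplier p k the two vertices are told apart at k: p k does not divide 1 - p k, so
      -- the exponent there stays at m k ∸ 1.
      ... | no i≢k = k , 0 , exact-∤ (prime k) (prime∤1-p (prime k)) , bound
        where
        bound : e i k ℕ.+ 0 < m k
        bound with k ≟ i | k ≟ k
        ... | yes k≡i | _      = contradiction (sym k≡i) i≢k
        ... | no _    | no k≢k = contradiction refl k≢k
        ... | no _    | yes _  = subst (_< m k) (sym (ℕ.+-identityʳ (m k ∸ 1)))
          (ℕ.≤-reflexive (ℕ.m+[n∸m]≡n (1≤m k)))

      m≤ : ∀ {i j} → i ≢ j → ∀ l → m l ≤ e i l ℕ.+ e j l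
      m≤ {i} {j} i≢j l with l ≟ i | l ≟ j | l ≟ k
      ... | yes refl | yes l≡j | _        = contradiction l≡j i≢j
      ... | yes _    | no _    | yes refl = ℕ.≤-reflexive (sym (ℕ.m+[n∸m]≡n (1≤m l)))
      ... | yes _    | no _    | no _     = ℕ.≤-refl
      ... | no _     | yes _   | yes refl = ℕ.≤-reflexive (sym (ℕ.m∸n+n≡m (1≤m l)))
      ... | no _     | yes _   | no _     = ℕ.≤-reflexive (sym (ℕ.+-identityʳ (m l)))
      ... | no _     | no _    | no _     = ℕ.m≤m+n _ _
      -- Here both exponents are m k ∸ 1, and 1 ≤ m k ∸ 1.
      ... | no _     | no _    | yes refl = ℕ.≤-trans (ℕ.≤-reflexive (sym (ℕ.m+[n∸m]≡n (1≤m l))))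
        (ℕ.+-monoˡ-≤ (m l ∸ 1) (ℕ.∸-monoˡ-≤ 1 (ℕ.<⇒≤ 3≤m)))

      cube⇒≤ : ∀ {d} → Box d → (∀ i → ∃ λ k → i ≢ k) → n ≤ d
      cube⇒≤ box other = twists⇒≤ box other e t p∤t 2e<m 1-t m≤

    -- Upper bounds from explicit representations.

    module UpperBounds (finite : Finite (quotientSetoid ⟨ g ⟩)) where

      private
        element : Fin (proj₁ finite) → Carrier
        element = Bijection.to (proj₂ finite)

      index : Carrier → Fin (proj₁ finite)
      index x = proj₁ (Bijection.strictlySurjective (proj₂ finite) x)

      element-index : ∀ x → element (index x) ~ x
      element-index x = proj₂ (Bijection.strictlySurjective (proj₂ finite) x)

      index-cong : ∀ {x y} → x ~ y → index x ≡ index y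
      index-cong {x} {y} x~y = Bijection.injective (proj₂ finite)
        (Q.trans (element-index x) (Q.trans x~y (Q.sym (element-index y))))

      index-injective : ∀ {x y} → index x ≡ index y → x ~ y
      index-injective {x} {y} eq = Q.trans (Q.sym (element-index x))
        (Q.trans (Q.reflexive (cong element eq)) (element-index y))

      box-n : Box n
      box-n = shapes⇒intersection Γ (index ∘ proj₁) index-cong index-injective
        (λ i x → levelShape (m i) (v i (proj₁ x)))
        (λ i x~y → cong (levelShape (m i)) (v-cong i x~y))
        (λ {x} {y} x≁y → mk⇔
          (λ (_ , xy~0) i → from (compatible i x y) (to *~0⇔ xy~0 i))
          (λ h → x≁y , from *~0⇔ λ i → to (compatible i x y) (h i)))
        where
        compatible : ∀ i x y → _
        compatible i x y = levelShape-compatible (m i) (v i (proj₁ x)) (v i (proj₁ y))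

      v≱1⇒∤ : ∀ {k x} → ¬ (1 ≤ v k x) → p k ∤ x
      v≱1⇒∤ {k} v≱1 p∣x = v≱1 (to (∣⇔≤v (1≤m k)) (∣-respˡ (≈-sym (*-identityʳ (p k))) p∣x))

      -- Both exponents at k are 0, so x and y lie in the only non-zero class modulo p k.
      residue-~ : ∀ k {x y} → m k ≡ 1 → HasCardinality (quotientSetoid ⟨ p k ⟩) 2 →
        ¬ (1 ≤ v k x ℕ.+ v k y) → p k ^ m k ∣ x - y
      residue-~ k {x} {y} m≡1 two v+v≱1 = subst (λ e → p k ^ e ∣ x - y) (sym m≡1)
        (∣-respˡ (≈-sym (*-identityʳ (p k))) (twoResidues (prime k) two
          (v≱1⇒∤ λ h → v+v≱1 (ℕ.≤-trans h (ℕ.m≤m+n _ _)))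
          (v≱1⇒∤ λ h → v+v≱1 (ℕ.≤-trans h (ℕ.m≤n+m _ _)))))

      box-without : ∀ {d} k → m k ≡ 1 → HasCardinality (quotientSetoid ⟨ p k ⟩) 2 →
        (∀ i → m i ≡ 1 ⊎ m i ≡ 2) →
        (φ : Fin d → Fin n) → (∀ i → i ≢ k → ∃ λ j → φ j ≡ i) → Box d
      box-without {d} k m≡1 two m≤2 φ onto = shapes⇒intersection Γ (index ∘ proj₁)
        index-cong index-injective
        (λ j x → rankShape (rank (m≤2 (φ j)) (v (φ j) (proj₁ x))) (v k (proj₁ x)))
        (λ j x~y → cong₂ rankShape (cong (rank (m≤2 (φ j))) (v-cong (φ j) x~y)) (v-cong k x~y))
        (λ {x} {y} x≁y → mk⇔
          (λ (_ , xy~0) j → from (compatible j (proj₁ x) (proj₁ y))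
            (from (rank-+⇔ (m≤2 (φ j))) (to *~0⇔ xy~0 (φ j)) ,
              inj₁ (ℕ.≤-trans (ℕ.≤-reflexive (sym m≡1)) (to *~0⇔ xy~0 k))))
          (λ h → x≁y , from *~0⇔ (sum-≥ x≁y λ j → to (compatible j (proj₁ x) (proj₁ y)) (h j))))
        where
        Meet : Fin d → Carrier → Carrier → Set
        Meet j x y = RanksMeet (rank (m≤2 (φ j)) (v (φ j) x)) (rank (m≤2 (φ j)) (v (φ j) y))
          (v k x) (v k y)
        compatible : ∀ j x y →
          Compatible (rankShape (rank (m≤2 (φ j)) (v (φ j) x)) (v k x))
            (rankShape (rank (m≤2 (φ j)) (v (φ j) y)) (v k y)) ⇔ Meet j x y
        compatible j x y = rankShape-compatible
          (rank-≤ (m≤2 (φ j)) (v≤m (φ j) x)) (rank-≤ (m≤2 (φ j)) (v≤m (φ j) y))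
          (subst (v k x ≤_) m≡1 (v≤m k x)) (subst (v k y ≤_) m≡1 (v≤m k y))
        sum-≥ : ∀ {x y} → x ≁ y → (∀ j → Meet j x y) → ∀ i → m i ≤ v i x ℕ.+ v i y
        sum-≥ {x} {y} x≁y meet i with 1 ℕ.≤? v k x ℕ.+ v k y
        ... | yes 1≤v+v with i ≟ k
        ...   | yes refl = ℕ.≤-trans (ℕ.≤-reflexive m≡1) 1≤v+v
        ...   | no i≢k with j , refl ← onto i i≢k = to (rank-+⇔ (m≤2 i)) (proj₁ (meet j))
        -- When the condition at k fails, every graph must use its waiver: x and y are full at all
        -- other primes and agree at k, so they are equal in Q.
        sum-≥ {x} {y} x≁y meet i | no v+v≱1 = contradiction (from ∣-local local) x≁y
          where
          local : ∀ i → p i ^ m i ∣ x - y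
          local i with i ≟ k
          ... | yes refl = residue-~ k m≡1 two v+v≱1
          ... | no i≢k with j , refl ← onto i i≢k | proj₂ (meet j)
          ...   | inj₁ 1≤v+v = contradiction 1≤v+v v+v≱1
          ...   | inj₂ (2≤r , 2≤s) = Modulo.∣-minus (p i ^ m i)
            (from (∣⇔≤v ℕ.≤-refl) (rank-full (m≤2 i) 2≤r))
            (from (∣⇔≤v ℕ.≤-refl) (rank-full (m≤2 i) 2≤s))

      -- Vertices that p k divides neither of are both divisible by the other prime and agree modulo
      -- p k, hence coincide; so the graph is complete.
      box-0 : (∀ i → m i ≡ 1 × HasCardinality (quotientSetoid ⟨ p i ⟩) 2) →
        (∀ {i k} → i ≢ k → ∀ l → l ≡ i ⊎ l ≡ k) → Box 0
      box-0 small two = (λ ()) , (λ ()) ,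
        λ {x} {y} x≁y → mk⇔ (λ _ ()) (λ _ → x≁y , from *~0⇔ (sum-≥ x y x≁y))
        where
        divisible : ∀ (x : Setoid.Carrier V) {i k} → i ≢ k → ¬ (1 ≤ v k (proj₁ x)) →
          1 ≤ v i (proj₁ x)
        divisible (x , (s , s≁0 , xs~0) , _) {i} {k} i≢k v≱1 with 1 ℕ.≤? v i x
        ... | yes h = h
        -- If neither prime divides x, then x s ~ 0 forces full exponents of s everywhere, so s ~ 0.
        ... | no h  = contradiction (from ~0⇔ λ l → ℕ.≤-trans (to *~0⇔ xs~0 l)
          (ℕ.≤-reflexive (cong (ℕ._+ v l s) (vanishes l)))) s≁0
          where
          vanishes : ∀ l → v l x ≡ 0
          vanishes l with two i≢k l
          ... | inj₁ refl = ℕ.n<1⇒n≡0 (ℕ.≰⇒> h)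
          ... | inj₂ refl = ℕ.n<1⇒n≡0 (ℕ.≰⇒> v≱1)
        sum-≥ : ∀ (x y : Setoid.Carrier V) → proj₁ x ≁ proj₁ y →
          ∀ k → m k ≤ v k (proj₁ x) ℕ.+ v k (proj₁ y)
        sum-≥ x y x≁y k with 1 ℕ.≤? v k (proj₁ x) ℕ.+ v k (proj₁ y)
        ... | yes h = ℕ.≤-trans (ℕ.≤-reflexive (proj₁ (small k))) h
        ... | no v+v≱1 = contradiction (from ∣-local local) x≁y
          where
          at : ∀ {i} (z : Setoid.Carrier V) → i ≢ k → ¬ (1 ≤ v k (proj₁ z)) → p i ^ m i ∣ proj₁ z
          at {i} z i≢k v≱1 = from (∣⇔≤v ℕ.≤-refl)
            (ℕ.≤-trans (ℕ.≤-reflexive (proj₁ (small i))) (divisible z i≢k v≱1))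
          local : ∀ i → p i ^ m i ∣ proj₁ x - proj₁ y
          local i with i ≟ k
          ... | yes refl = residue-~ k (proj₁ (small k)) (proj₂ (small k)) v+v≱1
          ... | no i≢k = Modulo.∣-minus (p i ^ m i)
            (at x i≢k λ h → v+v≱1 (ℕ.≤-trans h (ℕ.m≤m+n _ _)))
            (at y i≢k λ h → v+v≱1 (ℕ.≤-trans h (ℕ.m≤n+m _ _)))

-- Assembly of the five cases.

thirdElement : ∀ {n} (i k : Fin (3 ℕ.+ n)) → ∃ λ l → l ≢ i × l ≢ k
thirdElement i k with i ≟ k
... | yes refl = punchIn i zero , punchInᵢ≢i i zero , punchInᵢ≢i i zero
... | no i≢k   = punchIn i (punchIn (punchOut i≢k) zero) , punchInᵢ≢i i _ , λ eq →
  punchInᵢ≢i (punchOut i≢k) zero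
    (punchIn-injective i _ _ (≡.trans eq (sym (punchIn-punchOut i≢k))))

theorem79 : ∀ {c ℓ} (R : CommutativeRing c ℓ) →
    let open RingNotions R in
    IsPrincipalIdealDomain →
    (g : Carrier) →
    IsProper ⟨ g ⟩ →
    ¬ IsPrimeIdeal ⟨ g ⟩ →
    Finite (quotientSetoid ⟨ g ⟩) →
    (n : ℕ) (u : Carrier) (p : Vector Carrier n) (m : Vector ℕ n) →
    IsUnit u →
    (∀ i → Prime (p i)) →
    (∀ i j → i ≢ j → p i ∦ p j) →
    (∀ i → m i ≥ 1) →
    g ≈ u * product (λ i → p i ^ m i) →
    n ≥ 2 →
    let Γ = zeroDivisorGraph (quotientRing ⟨ g ⟩)
        R/p = λ i → quotientSetoid ⟨ p i ⟩ in
    ((∃ λ i → m i ≥ 3) → HasBoxicity Γ n) ×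
    ((∀ i → m i ≡ 2 ⊎ HasAtLeast (R/p i) 3) → HasBoxicity Γ n) ×
    (n ≥ 3 → (∀ i → m i ≡ 1 ⊎ m i ≡ 2) →
      (∃ λ i → m i ≡ 1 × HasCardinality (R/p i) 2) → HasBoxicity Γ (n ∸ 1)) ×
    (n ≡ 2 → (∀ i → m i ≡ 1 ⊎ m i ≡ 2) →
      (∃! _≡_ λ i → m i ≡ 1 × HasCardinality (R/p i) 2) → HasBoxicity Γ 1) ×
    (n ≡ 2 → (∀ i → m i ≡ 1 × HasCardinality (R/p i) 2) → HasBoxicity Γ 0)
theorem79 R pid g _ _ finite (suc (suc n)) u p m unit prime p∦p 1≤m g≈ (s≤s (s≤s z≤n)) =
  (λ (k , 3≤m) → box-n , λ _ box → Cube.cube⇒≤ k 3≤m box other) ,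
  (λ h → box-n , λ _ box → allTwists⇒≤ box other λ i →
    [ square⇒twist i , threeResidues⇒twist i ]′ (h i)) ,
  (λ { (s≤s (s≤s (s≤s z≤n))) m≤2 (k , m≡1 , two) → box-pred k m≡1 two m≤2 ,
    λ _ box → ℕ.≤-pred (D-pairs⇒≤ box thirdElement) }) ,
  (λ { refl m≤2 (k , (m≡1 , two) , unique) → box-pred k m≡1 two m≤2 , λ _ box →
    let l , k≢l = other k in twist⇒1≤ box (k≢l ∘ sym)
      -- Without a multiplier at l, the index l would satisfy m l = 1 with two residues as well,
      -- against the uniqueness of k.
      (decidable-stable (excludedMiddle (Twist l)) λ ¬twist → k≢l (unique
        ([ id , (λ m≡2 → contradiction (square⇒twist l m≡2) ¬twist) ]′ (m≤2 l) ,
          ¬twist⇒twoResidues l ¬twist))) }) ,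
  (λ { refl small → box-0 small covers , λ _ _ → z≤n })
  where
  open Domain R pid
  open Factored p m unit prime p∦p 1≤m g≈
  open UpperBounds finite

  other : ∀ {n} (i : Fin (2 ℕ.+ n)) → ∃ λ k → i ≢ k
  other i = punchIn i zero , punchInᵢ≢i i zero ∘ sym

  box-pred : ∀ k → m k ≡ 1 → _ → (∀ i → m i ≡ 1 ⊎ m i ≡ 2) → Box (suc n)
  box-pred k m≡1 two m≤2 = box-without k m≡1 two m≤2 (punchIn k)
    λ i i≢k → punchOut (i≢k ∘ sym) , punchIn-punchOut (i≢k ∘ sym)

  covers : ∀ {i k : Fin 2} → i ≢ k → ∀ l → l ≡ i ⊎ l ≡ k
  covers {0F} {_}  _ 0F = inj₁ refl
  covers {1F} {_}  _ 1F = inj₁ refl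
  covers {_}  {0F} _ 0F = inj₂ refl
  covers {_}  {1F} _ 1F = inj₂ refl
  covers {0F} {0F} h _  = contradiction refl h
  covers {1F} {1F} h _  = contradiction refl h
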